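{- Let $n$ be a positive integer, $1\le k\le n$, $w\in\mathfrak S_n$. The map $\mathrm{Rev}_{n,k,w}:\mathcal B_w(n,k)\to\mathcal C_w(n,k+1)$, $[\rho]\mapsto\mathrm{Rev}_{n,k,w}(\rho)$, is a well-defined poset isomorphism, and its inverse sends $R\in\mathcal C_w(n,k+1)$ to the set $\mathscr L(\mathrm{Inv}_k(w),\le_R)$ of linear extensions of $(\mathrm{Inv}_k(w),\le_R)$ (which is a single commutation class).
   Context: $\mathfrak S_n$ is the symmetric group on $[n]$. For $m\ge0$, $\binom{[n]}{m}$ is the set of $m$-subsets of $[n]$ written $[x_1,\dots,x_m]$ with $x_1<\dots<x_m$; $X_i$ is $X$ with $x_i$ removed; $P(X)=\{X_1,\dots,X_m\}$ with lex order $(X_m,\dots,X_1)$ and antilex order $(X_1,\dots,X_m)$; a prefix is a set $\{X_m,\dots,X_i\}$, a suffix a set $\{X_i,\dots,X_1\}$ (empty set counts as both). $\mathrm{Inv}_m(w)=\{[x_1,\dots,x_m]\in\binom{[n]}{m}:w^{ -1}(x_1)>\dots>w^{ -1}(x_m)\}$. $X$ is an $m$-quasi-inversion if exactly one pair $[x_a,x_b]$, $a<b$, is not in $\mathrm{Inv}_2(w)$. Quasi-inversion relations on $\mathrm{Inv}_m(w)$: for a quasi-inversion $X\in\binom{[n]}{m+1}$ with $P(X)\cap\mathrm{Inv}_m(w)=\{X_i,X_{i+1}\}$, $X_i<X_{i+1}$ if $m-i$ is odd, $X_{i+1}<X_i$ if $m-i$ is even; $\mathcal P_w(n,m)$ is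 the reflexive-transitive closure on $\mathrm{Inv}_m(w)$. $\mathcal A_w(n,k)$: total orders $\rho$ of $\mathrm{Inv}_k(w)$ that are linear extensions of $\mathcal P_w(n,k)$ with $\rho|_{P(X)}$ lex or antilex for every $X\in\mathrm{Inv}_{k+1}(w)$. $\mathrm{Rev}_{n,k,w}(\rho)=\{X\in\mathrm{Inv}_{k+1}(w):\rho|_{P(X)}=(X_1,\dots,X_{k+1})\}$. Elements of $\mathrm{Inv}_k(w)$ commute if incomparable in $\mathcal P_w(n,k)$ and not both in some packet $P(Z)$, $Z\in\binom{[n]}{k+1}$; $\sim_w$ is generated by swapping adjacent commuting elements. For $X\in\mathrm{Inv}_{k+1}(w)$ whose packet occupies consecutive positions of $\rho$ in lex order, the lex-to-antilex packet flip reverses that block. $\mathcal B_w(n,k)$ is the poset on $\mathcal A_w(n,k)/\!\sim_w$ with $[\rho]\le[\sigma]$ iff $\sigma$ is obtained from $\rho$ by commutations and lex-to-antilex packet flips. $R\subseteq\mathrm{Inv}_{m}(w)$ is consistent if it is a lower ideal of $\mathcal P_w(n,m)$ and $P(X)\cap R$ is a prefix or suffix of $P(X)$ for all $X\in\mathrm{Inv}_{m+1}(w)$; $\mathcal C_w(n,m)$ is the set of consistent sets ordered by $R\le R'$ iff there is a chain of consistent sets $R=R_0\subset\dots\subset R_t=R'$ with $|R_{j+1}\setminus R_j|=1$. For $R\in\mathcal C_w(n,k+1)$, $G_R$ is the directed graph on $\mathrm{Inv}_k(w)$ with edges $X\to Y$ for each quasi-inversion relation $X<Y$ on $\mathrm{Inv}_k(w)$,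 $X_i\to X_{i+1}$ ($1\le i\le k$) for $X\in R$, and $X_{i+1}\to X_i$ ($1\le i\le k$) for $X\in\mathrm{Inv}_{k+1}(w)\setminus R$. $G_R$ is acyclic, and $\le_R$ denotes the partial order on $\mathrm{Inv}_k(w)$ given by its reflexive-transitive closure. -}

module Defs where

open import Level using (0ℓ) renaming (suc to lsuc)
open import Data.Nat.Base as ℕ using (ℕ; suc; _∸_; parity)
open import Data.Fin.Base as Fin using (Fin; toℕ; inject₁)
import Data.Fin.Properties as Fin
open import Data.Fin.Permutation using (Permutation′; _⟨$⟩ˡ_)
open import Data.List.Base as List using (List; []; _∷_; _++_; reverse; tabulate; filter)
import Data.List.Properties as List
import Data.List.Membership.DecPropositional as DecMembership
open import Data.List.Relation.Binary.Sublist.Propositional using () renaming (_⊆_ to _⊑_)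
open import Data.List.Relation.Unary.Unique.Propositional using (Unique)
open import Data.Parity.Base using (0ℙ; 1ℙ)
open import Data.Product.Base using (∃; Σ-syntax; _×_; _,_; proj₁)
open import Data.Sum.Base using (_⊎_)
open import Data.Vec.Base as Vec using (Vec; []; _∷_; lookup; removeAt)
import Data.Vec.Properties as Vec
open import Data.Vec.Relation.Unary.Linked using (Linked; linked?)
open import Function.Base using (_on_)
open import Function.Bundles using (_⇔_)
open import Relation.Binary.Construct.Closure.Equivalence using (EqClosure)
open import Relation.Binary.Construct.Closure.ReflexiveTransitive using (Star)
open import Relation.Binary.Construct.Union using () renaming (_∪_ to _∪ᵣ_)
open import Relation.Binary.Core using (Rel)
open import Relation.Binary.Definitions using (DecidableEquality)
open import Relation.Binary.PropositionalEquality.Core using (_≡_; _≢_)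
open import Relation.Nullary.Decidable using (_×-dec_)
open import Relation.Nullary.Negation.Core using (¬_)
open import Relation.Unary using (Pred; Decidable; _∈_; _∉_; _⊆_; _∩_; _∪_; _∖_; _≐_; ｛_｝)

-- [n] is modelled by Fin n, and a subset {x₁ < ⋯ < xₘ} of [n] by the vector
-- (x₁ , … , xₘ).  A vector denotes an m-subset only when it is Increasing; sets
-- of m-subsets are predicates on vectors that imply Increasing.

Tuple : ℕ → ℕ → Set
Tuple n m = Vec (Fin n) m

_≟_ : ∀ {n m} → DecidableEquality (Tuple n m)
_≟_ = Vec.≡-dec Fin._≟_

Increasing : ∀ {n m} → Pred (Tuple n m) 0ℓ
Increasing = Linked Fin._<_

-- Indices are 0-based: face X i is Xᵢ₊₁ in the 1-based notation X₁ , … , Xₘ.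

face : ∀ {n m} → Tuple n (suc m) → Fin (suc m) → Tuple n m
face = removeAt

antilex lex : ∀ {n m} → Tuple n (suc m) → List (Tuple n m)
antilex X = tabulate (face X)
lex X     = reverse (antilex X)

module _ {n m : ℕ} where
  open DecMembership (_≟_ {n} {m}) using (_∈?_) renaming (_∈_ to _∈ₗ_)

  Packet : Tuple n (suc m) → Pred (Tuple n m) 0ℓ
  Packet X Y = Y ∈ₗ antilex X

  infix 8 _∣_
  _∣_ : List (Tuple n m) → Tuple n (suc m) → List (Tuple n m)
  ρ ∣ X = filter (_∈? antilex X) ρ

  -- {X_{m+1} , … , X_{c+1}}: empty when c exceeds every index.

  Prefix : Tuple n (suc m) → ℕ → Pred (Tuple n m) 0ℓ
  Prefix X c Y = ∃ λ i → c ℕ.≤ toℕ i × Y ≡ face X i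

  -- {X_c , … , X₁}: empty when c is 0.

  Suffix : Tuple n (suc m) → ℕ → Pred (Tuple n m) 0ℓ
  Suffix X c Y = ∃ λ i → toℕ i ℕ.< c × Y ≡ face X i

  -- A total order on a finite set V is the list of its elements in order.

  IsTotalOrderOn : Pred (Tuple n m) 0ℓ → Pred (List (Tuple n m)) 0ℓ
  IsTotalOrderOn V ρ = Unique ρ × (∀ X → X ∈ₗ ρ ⇔ X ∈ V)

  Precedes : List (Tuple n m) → Rel (Tuple n m) 0ℓ
  Precedes ρ X Y = (X ∷ Y ∷ []) ⊑ ρ

  LinearExtension : Pred (Tuple n m) 0ℓ → Rel (Tuple n m) 0ℓ → Pred (List (Tuple n m)) 0ℓ
  LinearExtension V _≤_ ρ =
    IsTotalOrderOn V ρ × (∀ {X Y} → X ≤ Y → X ≢ Y → Precedes ρ X Y)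

module _ {n : ℕ} (w : Permutation′ n) where

  Inv : ∀ {m} → Pred (Tuple n m) 0ℓ
  Inv X = Increasing X × Linked Fin._>_ (Vec.map (w ⟨$⟩ˡ_) X)

  Inv? : ∀ {m} → Decidable (Inv {m})
  Inv? X = linked? Fin._<?_ X ×-dec linked? (λ x y → y Fin.<? x) (Vec.map (w ⟨$⟩ˡ_) X)

  NonInvPair : ∀ {m} → Tuple n m → Fin m → Fin m → Set
  NonInvPair X a b = a Fin.< b × (lookup X a ∷ lookup X b ∷ []) ∉ Inv

  QuasiInversion : ∀ {m} → Pred (Tuple n m) 0ℓ
  QuasiInversion {m} X =
    Increasing X ×
    Σ[ a ∈ Fin m ] Σ[ b ∈ Fin m ]
      NonInvPair X a b × (∀ a′ b′ → NonInvPair X a′ b′ → a′ ≡ a × b′ ≡ b)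

  MeetsInvAt : ∀ {m} → Tuple n (suc m) → Fin m → Set
  MeetsInvAt X i = (Packet X ∩ Inv) ≐ (｛ face X (inject₁ i) ｝ ∪ ｛ face X (Fin.suc i) ｝)

  -- The 1-based index of the face at i : Fin m is toℕ i + 1, so the parity
  -- deciding the direction is that of m - (toℕ i + 1).

  data QuasiRel {m : ℕ} : Rel (Tuple n m) 0ℓ where
    odd  : ∀ {X} i → X ∈ QuasiInversion → MeetsInvAt X i →
           parity (m ∸ suc (toℕ i)) ≡ 1ℙ →
           QuasiRel (face X (inject₁ i)) (face X (Fin.suc i))
    even : ∀ {X} i → X ∈ QuasiInversion → MeetsInvAt X i →
           parity (m ∸ suc (toℕ i)) ≡ 0ℙ →
           QuasiRel (face X (Fin.suc i)) (face X (inject₁ i))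

  -- The order of 𝒫_w(n,m).  On tuples outside Inv it is just equality.

  _≤𝒫_ : ∀ {m} → Rel (Tuple n m) 0ℓ
  _≤𝒫_ = Star QuasiRel

  record 𝒜 (k : ℕ) (ρ : List (Tuple n k)) : Set where
    field
      linearExtension : LinearExtension Inv _≤𝒫_ ρ
      admissible      : ∀ {X} → X ∈ Inv → ρ ∣ X ≡ lex X ⊎ ρ ∣ X ≡ antilex X

  Rev : ∀ {k} → List (Tuple n k) → Pred (Tuple n (suc k)) 0ℓ
  Rev ρ X = X ∈ Inv × ρ ∣ X ≡ antilex X

  Rev? : ∀ {k} (ρ : List (Tuple n k)) → Decidable (Rev ρ)
  Rev? ρ X = Inv? X ×-dec List.≡-dec _≟_ (ρ ∣ X) (antilex X)

  record Commute {k : ℕ} (X Y : Tuple n k) : Set where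
    field
      X∈Inv    : X ∈ Inv
      Y∈Inv    : Y ∈ Inv
      X≰Y      : ¬ (X ≤𝒫 Y)
      Y≰X      : ¬ (Y ≤𝒫 X)
      noPacket : ∀ {Z} → Z ∈ Increasing → ¬ (X ∈ Packet Z × Y ∈ Packet Z)

  -- Swaps and flips are relations between arbitrary lists; both send members
  -- of 𝒜 to members of 𝒜.

  data Swap {k : ℕ} : Rel (List (Tuple n k)) 0ℓ where
    swap : ∀ α {X Y} β → Commute X Y → Swap (α ++ X ∷ Y ∷ β) (α ++ Y ∷ X ∷ β)

  data Flip {k : ℕ} : Rel (List (Tuple n k)) 0ℓ where
    flip : ∀ α {X} β → X ∈ Inv → Flip (α ++ lex X ++ β) (α ++ antilex X ++ β)

  -- ℬ_w(n,k) is the setoid of members of 𝒜 up to _∼_, ordered by _≤ℬ_.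

  ℬ : ℕ → Set
  ℬ k = ∃ (𝒜 k)

  _∼_ : ∀ {k} → Rel (ℬ k) 0ℓ
  _∼_ = EqClosure Swap on proj₁

  _≤ℬ_ : ∀ {k} → Rel (ℬ k) 0ℓ
  _≤ℬ_ = Star (Swap ∪ᵣ Flip) on proj₁

  Class : ∀ {k} → ℬ k → Pred (List (Tuple n k)) 0ℓ
  Class {k} ρ τ = Σ[ τ∈𝒜 ∈ 𝒜 k τ ] (τ , τ∈𝒜) ∼ ρ

  record Consistent {m : ℕ} (R : Pred (Tuple n m) 0ℓ) : Set where
    field
      R⊆Inv          : R ⊆ Inv
      lowerIdeal     : ∀ {X Y} → X ≤𝒫 Y → Y ∈ R → X ∈ R
      prefixOrSuffix : ∀ {X} → X ∈ Inv →
        (∃ λ c → (Packet X ∩ R) ≐ Prefix X c) ⊎ (∃ λ c → (Packet X ∩ R) ≐ Suffix X c)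

  -- Subsets of a finite set are decidable predicates, compared by _≐_.

  record 𝒞 (m : ℕ) : Set (lsuc 0ℓ) where
    field
      set        : Pred (Tuple n m) 0ℓ
      set?       : Decidable set
      consistent : Consistent set
  open 𝒞

  _≈𝒞_ : ∀ {m} → Rel (𝒞 m) 0ℓ
  _≈𝒞_ R S = set R ≐ set S

  _⋖_ : ∀ {m} → Rel (𝒞 m) 0ℓ
  R ⋖ S = set R ⊆ set S × ∃ λ X → (set S ∖ set R) ≐ ｛ X ｝

  -- The final _≈𝒞_ makes the relation respect equality of sets; it only
  -- matters for chains of length zero.

  _≤𝒞_ : ∀ {m} → Rel (𝒞 m) (lsuc 0ℓ)
  R ≤𝒞 S = ∃ λ R′ → Star _⋖_ R R′ × R′ ≈𝒞 S

  data Edge {k : ℕ} (R : Pred (Tuple n (suc k)) 0ℓ) : Rel (Tuple n k) 0ℓ where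
    quasi  : ∀ {X Y} → QuasiRel X Y → Edge R X Y
    inside : ∀ {X} i → X ∈ R → Edge R (face X (inject₁ i)) (face X (Fin.suc i))
    beyond : ∀ {X} i → X ∈ (Inv ∖ R) → Edge R (face X (Fin.suc i)) (face X (inject₁ i))

  ℒ : ∀ {k} → 𝒞 (suc k) → Pred (List (Tuple n k)) 0ℓ
  ℒ R = LinearExtension Inv (Star (Edge (set R)))

  RevConsistent : ℕ → Set
  RevConsistent k = ∀ {ρ} → ρ ∈ 𝒜 k → Consistent (Rev ρ)

  revMap : ∀ {k} → RevConsistent k → ℬ k → 𝒞 (suc k)
  revMap wd (ρ , ρ∈𝒜) = record { set = Rev ρ ; set? = Rev? ρ ; consistent = wd ρ∈𝒜 }

{-# OPTIONS --safe #-}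

-- A set R gives every (k+1)-subset Z a direction: the faces of Z that lie in Inv_k(w)
-- are to be met in antilex order if Z ∈ R and in lex order if Z ∈ Inv_{k+1}(w) ∖ R, while
-- for a quasi-inversion Z the parity rule decides.  Total orders of Inv_k(w) that follow
-- these directions are at once the linear extensions of ≤_R and the members of 𝒜 with
-- reversal set R.  Consistency of R says exactly that, for every (k+2)-subset X and all
-- a < b < c whose pairwise double faces are in Inv_k(w), the directions of X_a , X_b , X_c
-- do not alternate: an alternation is a 3-cycle among X_ab , X_ac , X_bc.
--
-- Conversely, non-alternation yields an order by recursion on the least letter c: put the
-- tuples c ∷ Y in one block, ordered by the link of c, and each tuple X without c below or
-- above that block according to the direction of c ∷ X.  This replaces acyclicity of G_R.
--
-- Two orders with the same directions differ by commutations, by bubble sort.  If S = R ∪ {X}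
-- and ρ , σ follow R and S, moving below the packet of X everything that no face of X
-- precedes in both ρ and σ makes the packet contiguous, so X can be flipped.
module Submission where

open import Defs
open import Data.Bool.Base using (Bool; true; false; not; if_then_else_)
import Data.Bool.Properties as Bool
open import Data.Fin.Base as Fin using (Fin; zero; suc; toℕ; inject₁; punchOut)
open import Data.Fin.Permutation using (Permutation′; _⟨$⟩ˡ_)
import Data.Fin.Properties as Fin
open import Data.List.Base as List using (List; []; _∷_; _++_; allFin; filter; reverse; tabulate)
import Data.List.Membership.DecPropositional as DecMembership
import Data.List.Membership.Propositional as List
open import Data.List.Membership.Propositional using (find; lose)
open import Data.List.Membership.Propositional.Properties
  using (∈-++⁺ˡ; ∈-++⁺ʳ; ∈-++⁻; ∈-allFin; ∈-filter⁺; ∈-filter⁻; ∈-map⁺; ∈-map⁻; ∈-tabulate⁺; ∈-tabulate⁻; ∈-∃++)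
open import Data.List.Properties using (filter-all)
open import Data.List.Relation.Binary.Permutation.Propositional using (_↭_; ↭-sym; ↭⇒↭ₛ)
  renaming (refl to ↭-refl; swap to ↭-swap)
open import Data.List.Relation.Binary.Permutation.Propositional.Properties using (∈-resp-↭; shift; ↭-reverse)
  renaming (++⁺ˡ to ↭-++⁺ˡ; ++⁺ʳ to ↭-++⁺ʳ)
import Data.List.Relation.Binary.Permutation.Setoid.Properties as ↭ₛ
import Data.List.Relation.Binary.Sublist.DecPropositional as DecSublist
open import Data.List.Relation.Binary.Sublist.Propositional
  using ([]; _∷_; _∷ʳ_; from∈; minimum; to∈; ⊆-refl; ⊆-trans) renaming (_⊆_ to _⊑_; lookup to ⊑-lookup)
open import Data.List.Relation.Binary.Sublist.Propositional.Properties
  using (All-resp-⊆; filter-⊆; filter⁺; reverse⁺; reverse⁻; ++⁺; ++⁺ˡ; ++⁺ʳ) renaming (map⁺ to ⊑-map⁺)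
open import Data.List.Relation.Unary.All as All using (All; []; _∷_)
open import Data.List.Relation.Unary.AllPairs using (AllPairs; []; _∷_)
import Data.List.Relation.Unary.AllPairs.Properties as AllPairs
open import Data.List.Relation.Unary.Any using (Any; any?; here; there)
open import Data.List.Relation.Unary.Unique.Propositional using (Unique)
import Data.List.Relation.Unary.Unique.Propositional.Properties as Unique
open import Data.Nat.Base as ℕ using (ℕ; zero; suc; parity; s<s; s≤s; z<s; z≤n; _≤_; _∸_)
import Data.Nat.Properties as ℕ
open import Data.Parity.Base using (0ℙ; 1ℙ)
open import Data.Product.Base using (Σ-syntax; ∃; ∃₂; proj₁; proj₂; _,_; _×_)
open import Data.Sum.Base using (fromInj₁; fromInj₂; inj₁; inj₂; _⊎_)
open import Data.Vec.Base using (Vec; []; _∷_; head; lookup; removeAt; toList)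
open import Data.Vec.Properties using (removeAt-punchOut; ∷-injectiveʳ; ∷-injectiveˡ)
open import Data.Vec.Relation.Unary.Linked as Linked using (Linked; [-]; []; _∷_)
import Data.Vec.Relation.Unary.Linked.Properties as Linked
open import Function.Base using (id; _∘_) renaming (flip to flip′)
open import Function.Bundles using (Equivalence; mk⇔)
open import Function.Definitions using (Inverseᵇ)
open import Level using (0ℓ)
open import Relation.Binary.Core using (Rel)
open import Relation.Binary.Construct.Closure.Equivalence using (EqClosure)
import Relation.Binary.Construct.Closure.Equivalence as EqClosure
open import Relation.Binary.Construct.Closure.ReflexiveTransitive as Star using (Star; ε; return; _◅_; _◅◅_)
open import Relation.Binary.Construct.Closure.Symmetric using (bwd; fwd)
import Relation.Binary.Construct.On as On
open import Relation.Binary.Construct.Union using () renaming (_∪_ to _∪ᵣ_)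
open import Relation.Binary.Definitions using (Transitive; tri<; tri≈; tri>)
open import Relation.Binary.Morphism.Structures using (IsOrderIsomorphism)
open import Relation.Binary.PropositionalEquality
open import Relation.Binary.Structures using (IsPartialOrder)
open import Relation.Nullary.Decidable
  using (Dec; dec-false; dec-true; decidable-stable; does; does-⇔; no; yes; ¬?; _×-dec_; _⊎-dec_)
open import Relation.Nullary.Negation using (contradiction; ¬_)
open import Relation.Unary using (Decidable; Pred; _∈_; _∉_; _⊆_; _≐_)

-- Order of occurrence in a duplicate-free list.

module _ {A : Set} where

  private
    variable
      x y z : A
      xs ys zs : List A

  Before : List A → Rel A 0ℓ
  Before xs x y = (x ∷ y ∷ []) ⊑ xs

  before-∈ˡ : Before xs x y → x List.∈ xs
  before-∈ˡ p = ⊑-lookup p (here refl)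

  before-∈ʳ : Before xs x y → y List.∈ xs
  before-∈ʳ p = ⊑-lookup p (there (here refl))

  before-head : y List.∈ xs → Before (x ∷ xs) x y
  before-head y∈xs = refl ∷ from∈ y∈xs

  before-asym : Unique xs → Before xs x y → ¬ Before xs y x
  before-asym (x≢ ∷ u) (_ ∷ʳ p)   (_ ∷ʳ q)   = before-asym u p q
  before-asym (x≢ ∷ u) (refl ∷ p) (_ ∷ʳ q)   = All.lookup x≢ (before-∈ʳ q) refl
  before-asym (x≢ ∷ u) (_ ∷ʳ p)   (refl ∷ q) = All.lookup x≢ (before-∈ʳ p) refl
  before-asym (x≢ ∷ u) (refl ∷ p) (refl ∷ q) = All.lookup x≢ (to∈ p) refl

  before-irrefl : Unique xs → ¬ Before xs x x
  before-irrefl u p = before-asym u p p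

  before-trans : Unique xs → Before xs x y → Before xs y z → Before xs x z
  before-trans (x≢ ∷ u) (_ ∷ʳ p)   (_ ∷ʳ q)   = _ ∷ʳ before-trans u p q
  before-trans (x≢ ∷ u) (refl ∷ p) (_ ∷ʳ q)   = before-head (before-∈ʳ q)
  before-trans (x≢ ∷ u) (_ ∷ʳ p)   (refl ∷ q) = contradiction refl (All.lookup x≢ (before-∈ʳ p))
  before-trans (x≢ ∷ u) (refl ∷ p) (refl ∷ q) = contradiction refl (All.lookup x≢ (to∈ p))

  before-connex : x List.∈ xs → y List.∈ xs → x ≢ y → Before xs x y ⊎ Before xs y x
  before-connex (here refl) (here refl) x≢y = contradiction refl x≢y
  before-connex (here refl) (there q)   x≢y = inj₁ (before-head q)
  before-connex (there p)   (here refl) x≢y = inj₂ (before-head p)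
  before-connex (there p)   (there q)   x≢y with before-connex p q x≢y
  ... | inj₁ b = inj₁ (_ ∷ʳ b)
  ... | inj₂ b = inj₂ (_ ∷ʳ b)

  before-++⁻ : ∀ xs → Before (xs ++ ys) x y → Before xs x y ⊎ (x List.∈ xs × y List.∈ ys) ⊎ Before ys x y
  before-++⁻ []       p          = inj₂ (inj₂ p)
  before-++⁻ (z ∷ xs) (.z ∷ʳ p) with before-++⁻ xs p
  ... | inj₁ b               = inj₁ (z ∷ʳ b)
  ... | inj₂ (inj₁ (i , j)) = inj₂ (inj₁ (there i , j))
  ... | inj₂ (inj₂ b)        = inj₂ (inj₂ b)
  before-++⁻ (z ∷ xs) (refl ∷ p) with ∈-++⁻ xs (to∈ p)
  ... | inj₁ i = inj₁ (before-head i)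
  ... | inj₂ i = inj₂ (inj₁ (here refl , i))

  before-++⁺ˡ : Before xs x y → Before (xs ++ ys) x y
  before-++⁺ˡ = ++⁺ʳ _

  before-++⁺ʳ : ∀ xs → Before ys x y → Before (xs ++ ys) x y
  before-++⁺ʳ = ++⁺ˡ

  before-across : x List.∈ xs → y List.∈ ys → Before (xs ++ ys) x y
  before-across p q = ++⁺ (from∈ p) (from∈ q)

  -- Replacing a contiguous block by another one can disturb only pairs lying inside the block.
  -- Swaps and packet flips are both handled this way.
  before-infix : ∀ zs {xs ys ws : List A} → (∀ {z} → z List.∈ xs → z List.∈ ys) → (Before xs x y → Before ys x y) →
                 Before (zs ++ xs ++ ws) x y → Before (zs ++ ys ++ ws) x y
  before-infix zs {xs} {ys} xs⊆ys f p with before-++⁻ zs p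
  ... | inj₁ b = before-++⁺ˡ b
  ... | inj₂ (inj₁ (i , j)) with ∈-++⁻ xs j
  ...   | inj₁ j′ = before-across i (∈-++⁺ˡ (xs⊆ys j′))
  ...   | inj₂ j′ = before-across i (∈-++⁺ʳ ys j′)
  before-infix zs {xs} {ys} xs⊆ys f p | inj₂ (inj₂ b) with before-++⁻ xs b
  ... | inj₁ c               = before-++⁺ʳ zs (before-++⁺ˡ (f c))
  ... | inj₂ (inj₁ (i , j)) = before-++⁺ʳ zs (before-across (xs⊆ys i) j)
  ... | inj₂ (inj₂ c)        = before-++⁺ʳ zs (before-++⁺ʳ ys c)

  module _ {P : Pred A 0ℓ} (P? : Decidable P) where

    before-filter⁻ : ∀ xs → Before (filter P? xs) x y → Before xs x y
    before-filter⁻ xs p = ⊆-trans p (filter-⊆ P? xs)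

    before-filter⁺ : Before xs x y → P x → P y → Before (filter P? xs) x y
    before-filter⁺ p px py =
      subst (_⊑ _) (filter-all P? (px ∷ py ∷ [])) (filter⁺ P? P? (λ { refl px → px }) p)

  before-tabulate⁺ : ∀ {m} (f : Fin m → A) {i j} → i Fin.< j → Before (tabulate f) (f i) (f j)
  before-tabulate⁺ f {zero}  {suc j} _         = before-head (∈-tabulate⁺ j)
  before-tabulate⁺ f {suc i} {suc j} (s<s i<j) = _ ∷ʳ before-tabulate⁺ (λ k → f (suc k)) i<j

  before-tabulate⁻ : ∀ {m} (f : Fin m → A) → Before (tabulate f) x y → ∃₂ λ i j → i Fin.< j × x ≡ f i × y ≡ f j
  before-tabulate⁻ {m = suc m} f (_ ∷ʳ p) with before-tabulate⁻ (λ k → f (suc k)) p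
  ... | i , j , i<j , p , q = suc i , suc j , s<s i<j , p , q
  before-tabulate⁻ {m = suc m} f (refl ∷ p) with ∈-tabulate⁻ (to∈ p)
  ... | j , q = zero , suc j , z<s , refl , q

  before-reverse⁺ : Before xs x y → Before (reverse xs) y x
  before-reverse⁺ = reverse⁺

  before-reverse⁻ : Before (reverse xs) x y → Before xs y x
  before-reverse⁻ = reverse⁻

  -- If the heads differed, each head would precede the other in its own list, an opposite pair that
  -- the last hypothesis excludes.
  before-ext : Unique xs → Unique ys → (∀ {z} → z List.∈ xs → z List.∈ ys) → (∀ {z} → z List.∈ ys → z List.∈ xs) →
               (∀ {x y} → Before xs x y → ¬ Before ys y x) → xs ≡ ys
  before-ext {xs = []}     {ys = []}     u v f g h = refl
  before-ext {xs = []}     {ys = y ∷ ys} u v f g h with () ← g (here refl)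
  before-ext {xs = x ∷ xs} {ys = []}     u v f g h with () ← f (here refl)
  before-ext {xs = x ∷ xs} {ys = y ∷ ys} (x≢ ∷ u) (y≢ ∷ v) f g h with f (here refl) | g (here refl)
  ... | there p | there q = contradiction (before-head p) (h (before-head q))
  ... | here refl | _ = cong (x ∷_) (before-ext u v f′ g′ (λ p q → h (_ ∷ʳ p) (_ ∷ʳ q)))
    where
    f′ : ∀ {z} → z List.∈ xs → z List.∈ ys
    f′ p with f (there p)
    ... | here refl = contradiction refl (All.lookup x≢ p)
    ... | there q   = q
    g′ : ∀ {z} → z List.∈ ys → z List.∈ xs
    g′ p with g (there p)
    ... | here refl = contradiction refl (All.lookup y≢ p)
    ... | there q   = q
  ... | there p | here refl = contradiction refl (All.lookup y≢ p)

-- Orders with prescribed directions, by recursion on the least letter.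

turn : ∀ {A : Set} → Bool → Rel A 0ℓ → Rel A 0ℓ
turn true  R x y = R x y
turn false R x y = R y x

module _ {n : ℕ} where

  private
    variable
      k m : ℕ
      V   : Pred (Tuple n k) 0ℓ

  face-∷ : ∀ x (X : Tuple n (suc m)) i → face (x ∷ X) (suc i) ≡ x ∷ face X i
  face-∷ x (_ ∷ _) i = refl

  face-face-∷ : ∀ x (X : Tuple n (suc (suc m))) a b →
                face (face (x ∷ X) (suc a)) (suc b) ≡ x ∷ face (face X a) b
  face-face-∷ x (_ ∷ _ ∷ _) zero    b = refl
  face-face-∷ x (_ ∷ _ ∷ _) (suc a) b = refl

  face-⊑ : (X : Tuple n (suc m)) (i : Fin (suc m)) → toList (face X i) ⊑ toList X
  face-⊑ (x ∷ X)     zero    = x ∷ʳ ⊆-refl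
  face-⊑ (x ∷ y ∷ X) (suc i) = refl ∷ face-⊑ (y ∷ X) i

  -- Non-alternation is asked also when the double face X_bc is not in V; the tuples X
  -- without c for which c ∷ X is not an inversion need this in order to be placed.

  Coherent : List (Fin n) → Pred (Tuple n k) 0ℓ → (Tuple n (suc k) → Bool) → Set
  Coherent ls V d = ∀ {X} → toList X ⊑ ls → ∀ {a b c} → toℕ a ℕ.≤ toℕ b → b Fin.< c →
    V (face (face X a) b) → V (face (face X a) c) →
    d (face X a) ≡ d (face X (suc b)) ⊎ d (face X (suc b)) ≡ d (face X (suc c))

  -- Coherence passes to the link of `c`: prepending `c` shifts all three indices by one and keeps
  -- the double faces in `V`.
  coherent-∷ : ∀ {c ls} (V : Pred (Tuple n (suc k)) 0ℓ) d →
               Coherent (c ∷ ls) V d → Coherent ls (V ∘ (c ∷_)) (d ∘ (c ∷_))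
  coherent-∷ {c = c} V d coh {X@(_ ∷ _ ∷ _)} p {a} {b} {b′} a≤b b<b′ v v′ =
    coh (refl ∷ p) {suc a} {suc b} {suc b′} (s≤s a≤b) (s<s b<b′)
      (subst V (sym (face-face-∷ c X a b)) v) (subst V (sym (face-face-∷ c X a b′)) v′)

  -- A tuple `X` without `c` is `face (c ∷ X) zero`, and every other face of `c ∷ X` contains `c`.
  -- So the direction `true` of `c ∷ X` asks `X` to precede the block of tuples containing `c`, and
  -- `false` asks it to follow.
  arrange : List (Fin n) → Decidable {A = Tuple n k} V → (Tuple n (suc k) → Bool) → List (Tuple n k)
  arrange {zero}  ls       V? d = filter V? ([] ∷ [])
  arrange {suc k} []       V? d = []
  arrange {suc k} (c ∷ ls) V? d =
    filter (λ X → d (c ∷ X) Bool.≟ true) (arrange ls V? d) ++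
    List.map (c ∷_) (arrange ls (V? ∘ (c ∷_)) (d ∘ (c ∷_))) ++
    filter (λ X → d (c ∷ X) Bool.≟ false) (arrange ls V? d)

  ∈-arrange⁺ : ∀ ls (V? : Decidable {A = Tuple n k} V) d {X} →
               toList X ⊑ ls → V X → X List.∈ arrange ls V? d
  ∈-arrange⁺ {zero}  ls       V? d {[]} p v = ∈-filter⁺ V? (here refl) v
  ∈-arrange⁺ {suc k} (c ∷ ls) V? d {x ∷ X} (.c ∷ʳ p) v with d (c ∷ x ∷ X) in eq
  ... | true  = ∈-++⁺ˡ (∈-filter⁺ _ (∈-arrange⁺ ls V? d p v) eq)
  ... | false =
      ∈-++⁺ʳ (filter _ (arrange ls V? d)) (∈-++⁺ʳ (List.map (c ∷_) (arrange ls (V? ∘ (c ∷_)) (d ∘ (c ∷_))))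
        (∈-filter⁺ _ (∈-arrange⁺ ls V? d p v) eq))
  ∈-arrange⁺ {suc k} (c ∷ ls) V? d {x ∷ X} (refl ∷ p) v =
    ∈-++⁺ʳ (filter _ (arrange ls V? d)) (∈-++⁺ˡ (∈-map⁺ (c ∷_) (∈-arrange⁺ ls (V? ∘ (c ∷_)) (d ∘ (c ∷_)) p v)))

  ∈-arrange⁻ : ∀ ls (V? : Decidable {A = Tuple n k} V) d {X} →
               X List.∈ arrange ls V? d → toList X ⊑ ls × V X
  ∈-arrange⁻ {zero}  ls       V? d {[]} p = minimum _ , proj₂ (∈-filter⁻ V? p)
  ∈-arrange⁻ {suc k} (c ∷ ls) V? d p with ∈-++⁻ (filter _ (arrange ls V? d)) p
  ... | inj₁ q = let (X⊑ , v) = ∈-arrange⁻ ls V? d (proj₁ (∈-filter⁻ _ q)) in (c ∷ʳ X⊑) , v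
  ... | inj₂ q with ∈-++⁻ (List.map (c ∷_) (arrange ls (V? ∘ (c ∷_)) (d ∘ (c ∷_)))) q
  ...   | inj₂ r = let (X⊑ , v) = ∈-arrange⁻ ls V? d (proj₁ (∈-filter⁻ _ r)) in (c ∷ʳ X⊑) , v
  ...   | inj₁ r with ∈-map⁻ (c ∷_) r
  ...     | Y , Y∈ , refl =
    let (Y⊑ , v) = ∈-arrange⁻ ls (V? ∘ (c ∷_)) (d ∘ (c ∷_)) Y∈ in (refl ∷ Y⊑) , v

  arrange-unique : ∀ ls (V? : Decidable {A = Tuple n k} V) d → Unique ls → Unique (arrange ls V? d)
  arrange-unique {zero}  ls       V? d u = Unique.filter⁺ V? ([] ∷ [])
  arrange-unique {suc k} []       V? d u = []
  arrange-unique {suc k} (c ∷ ls) V? d (c≢ ∷ u) =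
    Unique.++⁺ (Unique.filter⁺ _ uM)
      (Unique.++⁺ (Unique.map⁺ ∷-injectiveʳ (arrange-unique ls _ _ u)) (Unique.filter⁺ _ uM)
        (λ (p , q) → link∌ p (proj₁ (∈-filter⁻ _ q))))
      λ (p , q) → disjoint (∈-filter⁻ _ p) (∈-++⁻ (List.map (c ∷_) (arrange ls (V? ∘ (c ∷_)) (d ∘ (c ∷_)))) q)
    where
    uM : Unique (arrange ls V? d)
    uM = arrange-unique ls V? d u
    link∌ : ∀ {X} {Ys : List (Tuple n k)} → X List.∈ List.map (c ∷_) Ys → ¬ X List.∈ arrange ls V? d
    link∌ p q with ∈-map⁻ (c ∷_) p
    ... | _ , _ , refl = All.lookup c≢ (⊑-lookup (proj₁ (∈-arrange⁻ ls V? d q)) (here refl)) refl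
    disjoint : ∀ {X Ys} → X List.∈ arrange ls V? d × d (c ∷ X) ≡ true →
               ¬ (X List.∈ List.map (c ∷_) Ys ⊎ X List.∈ filter (λ X → d (c ∷ X) Bool.≟ false) (arrange ls V? d))
    disjoint (p , dt) (inj₁ q) = link∌ q p
    disjoint (p , dt) (inj₂ q) = contradiction
      (trans (sym dt) (proj₂ (∈-filter⁻ (λ X → d (c ∷ X) Bool.≟ false) {xs = arrange ls V? d} q))) λ ()

  -- Each of the two filtered parts keeps the order of `xs`, so a pair can only be reversed if `x`
  -- goes to the last part and `y` to the first.
  before-split : ∀ {f : Tuple n k → Bool} {xs ys x y} → Before xs x y → (f y ≡ true → f x ≡ true) →
                 Before (filter (λ z → f z Bool.≟ true) xs ++ ys ++ filter (λ z → f z Bool.≟ false) xs) x y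
  before-split {f = f} {xs} {ys} {x} {y} b h with f x in fx | f y in fy
  ... | true  | true  = before-++⁺ˡ (before-filter⁺ _ b fx fy)
  ... | true  | false = before-across (∈-filter⁺ _ (before-∈ˡ b) fx) (∈-++⁺ʳ ys (∈-filter⁺ _ (before-∈ʳ b) fy))
  ... | false | true  with () ← h refl
  ... | false | false = before-++⁺ʳ (filter _ xs) (before-++⁺ʳ ys (before-filter⁺ _ b fx fy))

  -- If `Z` omits `c`, the recursive order is right for `Z`, and non-alternation for `c ∷ Z` at the
  -- faces `Z`, `c ∷ face Z i`, `c ∷ face Z j` ensures that splitting around the block does not
  -- reverse the pair. If `Z` contains `c` and `i` is `zero`, one face is outside the block and the
  -- other inside. Otherwise both lie in the block and the link of `c` decides.
  arrange-oriented : ∀ ls (V? : Decidable {A = Tuple n k} V) d → Coherent ls V d →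
    ∀ {Z} → toList Z ⊑ ls → ∀ {i j} → i Fin.< j → V (face Z i) → V (face Z j) →
    turn (d Z) (Before (arrange ls V? d)) (face Z i) (face Z j)
  arrange-oriented {zero} ls V? d coh p {zero} {zero} () vi vj
  arrange-oriented {suc k} (c ∷ ls) V? d coh {Z@(_ ∷ _)} (.c ∷ʳ p) {i} {j} i<j vi vj
    with d Z | coh (refl ∷ p) z≤n i<j vi vj | arrange-oriented ls V? d (λ q → coh (c ∷ʳ q)) p i<j vi vj
  ... | true  | inj₁ e | b = before-split b (λ _ → sym e)
  ... | true  | inj₂ e | b = before-split b (trans e)
  ... | false | inj₁ e | b = before-split b (λ e′ → contradiction (trans e e′) λ ())
  ... | false | inj₂ e | b = before-split b (trans (sym e))
  arrange-oriented {suc k} (c ∷ ls) V? d coh {.c ∷ Z@(_ ∷ _)} (refl ∷ p) {zero} {suc j} i<j vi vj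
    with d (c ∷ Z) in eq | ∈-arrange⁺ ls V? d p vi
       | ∈-map⁺ (c ∷_) (∈-arrange⁺ ls (V? ∘ (c ∷_)) (d ∘ (c ∷_)) (⊆-trans (face-⊑ Z j) p) vj)
  ... | true  | Z∈ | Y∈ = before-across (∈-filter⁺ _ Z∈ eq) (∈-++⁺ˡ Y∈)
  ... | false | Z∈ | Y∈ = before-++⁺ʳ (filter _ (arrange ls V? d)) (before-across Y∈ (∈-filter⁺ _ Z∈ eq))
  arrange-oriented {suc k} {V = V} (c ∷ ls) V? d coh {.c ∷ Z@(_ ∷ _)} (refl ∷ p) {suc i} {suc j} (s<s i<j) vi vj
    with d (c ∷ Z) | arrange-oriented ls (V? ∘ (c ∷_)) (d ∘ (c ∷_)) (coherent-∷ V d coh) p i<j vi vj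
  ... | true  | b = before-++⁺ʳ (filter _ (arrange ls V? d)) (before-++⁺ˡ (⊑-map⁺ (c ∷_) b))
  ... | false | b = before-++⁺ʳ (filter _ (arrange ls V? d)) (before-++⁺ˡ (⊑-map⁺ (c ∷_) b))

-- Faces of tuples.

face-face : ∀ {A : Set} {m} (X : Vec A (suc (suc m))) {i j : Fin (suc m)} → i Fin.≤ j →
            removeAt (removeAt X (suc j)) i ≡ removeAt (removeAt X (inject₁ i)) j
face-face (x ∷ y ∷ X)     {zero}  {j}     _         = refl
face-face (x ∷ y ∷ z ∷ X) {suc zero}    {suc j} (s≤s i≤j) = cong (x ∷_) (face-face (y ∷ z ∷ X) i≤j)
face-face (x ∷ y ∷ z ∷ X) {suc (suc i)} {suc j} (s≤s i≤j) = cong (x ∷_) (face-face (y ∷ z ∷ X) i≤j)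

linked-removeAt : ∀ {A : Set} {R : Rel A 0ℓ} → Transitive R → ∀ {m} {X : Vec A (suc m)} i →
                  Linked R X → Linked R (removeAt X i)
linked-removeAt tr zero          [-]              = []
linked-removeAt tr zero          (_ ∷ rs)         = rs
linked-removeAt tr (suc zero)    (_ ∷ [-])        = [-]
linked-removeAt tr (suc zero)    (r ∷ r′ ∷ rs)    = tr r r′ ∷ rs
linked-removeAt tr {X = _ ∷ _ ∷ _ ∷ _} (suc (suc i)) (r ∷ rs) = r ∷ linked-removeAt tr (suc i) rs

module _ {n : ℕ} where

  face-∈ : ∀ {m} (X : Tuple n (suc m)) i → face X i ∈ Packet X
  face-∈ X i = ∈-tabulate⁺ {f = face X} i

  increasing-face : ∀ {m} {X : Tuple n (suc m)} i → Increasing X → Increasing (face X i)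
  increasing-face = linked-removeAt Fin.<-trans

  face-≢ : ∀ {m} {X : Tuple n (suc m)} → Increasing X → ∀ {i j} → i Fin.< j → face X i ≢ face X j
  face-≢ {X = _ ∷ _ ∷ _}     (x<y ∷ _) {zero}  {suc j} _         eq = Fin.<⇒≢ x<y (sym (∷-injectiveˡ eq))
  face-≢ {X = _ ∷ _ ∷ _ ∷ _} (_ ∷ inc) {suc i} {suc j} (s<s i<j) eq = face-≢ inc i<j (∷-injectiveʳ eq)
  face-≢ {X = _ ∷ _ ∷ []}    inc       {suc zero} {suc zero} (s<s ())
  face-≢ {X = _ ∷ []}        inc       {zero} {zero} ()

  face-injective : ∀ {m} {X : Tuple n (suc m)} → Increasing X → ∀ {i j} → face X i ≡ face X j → i ≡ j
  face-injective inc {i} {j} eq with Fin.<-cmp i j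
  ... | tri< i<j _ _ = contradiction eq (face-≢ inc i<j)
  ... | tri≈ _ i≡j _ = i≡j
  ... | tri> _ _ j<i = contradiction (sym eq) (face-≢ inc j<i)

-- Descents, ascents and quasi-inversions.

isOdd : ℕ → Bool
isOdd zero    = false
isOdd (suc m) = not (isOdd m)

module _ {n : ℕ} (w : Permutation′ n) where

  private
    variable
      m   : ℕ
      x y : Fin n
      X   : Tuple n m

  Descent : Rel (Fin n) 0ℓ
  Descent x y = (w ⟨$⟩ˡ y) Fin.< (w ⟨$⟩ˡ x)

  descent? : ∀ x y → Dec (Descent x y)
  descent? x y = (w ⟨$⟩ˡ y) Fin.<? (w ⟨$⟩ˡ x)

  descent-trans : Transitive Descent
  descent-trans p q = Fin.<-trans q p

  inv-∷ : x Fin.< y → Descent x y → Inv w (y ∷ X) → Inv w (x ∷ y ∷ X)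
  inv-∷ x<y d (inc , des) = x<y ∷ inc , d ∷ des

  inv-descent : Inv w (x ∷ y ∷ X) → Descent x y
  inv-descent (_ , d ∷ _) = d

  inv-tail : Inv w (x ∷ X) → Inv w X
  inv-tail (inc , des) = Linked.tail inc , Linked.tail des

  inv-face : {X : Tuple n (suc m)} → ∀ i → Inv w X → Inv w (face X i)
  inv-face {X = X} i (inc , des) =
    increasing-face i inc ,
    Linked.map⁺ (linked-removeAt (λ {x y z} → descent-trans {x} {y} {z}) {X = X} i (Linked.map⁻ des))

  inv-pair : ∀ {X : Tuple n m} {a b} → Inv w X → a Fin.< b → Inv w (lookup X a ∷ lookup X b ∷ [])
  inv-pair {X = X} (inc , des) a<b =
    Linked.lookup⁺ Fin.<-trans inc a<b ∷ [-] ,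
    Linked.lookup⁺ (λ {x y z} → descent-trans {x} {y} {z}) {xs = X} (Linked.map⁻ des) a<b ∷ [-]

  inv-face-pair : ∀ {X : Tuple n (suc m)} {i a b} → Inv w (face X i) → a Fin.< b → i ≢ a → i ≢ b →
                  Inv w (lookup X a ∷ lookup X b ∷ [])
  inv-face-pair {X = X} inv a<b i≢a i≢b =
    subst₂ (λ x y → Inv w (x ∷ y ∷ [])) (removeAt-punchOut X i≢a) (removeAt-punchOut X i≢b)
      (inv-pair inv (Fin.≤∧≢⇒< (Fin.punchOut-mono-≤ i≢a i≢b (ℕ.<⇒≤ a<b))
                               (Fin.<⇒≢ a<b ∘ Fin.punchOut-injective i≢a i≢b)))

  -- The number of letters after the first ascent, modulo 2.  On a quasi-inversion this is
  -- the parity in QuasiRel; the value on other tuples outside Inv only has to make orient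
  -- coherent in the sense of Coherent.

  ascentParity : Tuple n m → Bool
  ascentParity []          = false
  ascentParity (x ∷ [])    = false
  ascentParity {suc (suc m)} (x ∷ y ∷ X) = if does (descent? x y) then ascentParity (y ∷ X) else isOdd m

  parity-descent : ∀ (X : Tuple n m) → Descent x y → ascentParity (x ∷ y ∷ X) ≡ ascentParity (y ∷ X)
  parity-descent {x = x} {y} X d rewrite dec-true (descent? x y) d = refl

  parity-ascent : ∀ (X : Tuple n m) → ¬ Descent x y → ascentParity (x ∷ y ∷ X) ≡ isOdd m
  parity-ascent {x = x} {y} X ¬d rewrite dec-false (descent? x y) ¬d = refl

  -- A form of quasi-inversion suited to induction on the tuple. `quasiInversion`, `meetsInvAt` and
  -- `quasiAt⁺` show that it amounts to `QuasiInversion` together with `MeetsInvAt` at `i`.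
  record QuasiAt (X : Tuple n (suc m)) (i : Fin m) : Set where
    constructor quasiAt
    field
      increasing : Increasing X
      ∉Inv       : X ∉ Inv w
      invˡ       : face X (inject₁ i) ∈ Inv w
      invʳ       : face X (suc i) ∈ Inv w

  quasiAt-descent : ∀ {X : Tuple n (suc m)} {i} → QuasiAt (x ∷ y ∷ X) (suc i) → Descent x y
  quasiAt-descent {X = _ ∷ _} q = inv-descent (QuasiAt.invʳ q)

  quasiAt-tail : ∀ {X : Tuple n (suc m)} {i} → QuasiAt (x ∷ X) (suc i) → QuasiAt X i
  quasiAt-tail {X = _ ∷ _ ∷ _} q@(quasiAt (x<y ∷ inc) X∉ l r) =
    quasiAt inc (X∉ ∘ inv-∷ x<y (quasiAt-descent q)) (inv-tail l) (inv-tail r)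

  -- At position `zero`, a descent in front of the inversion left after removing the first letter
  -- would make `X` an inversion. Later positions reduce to this one by dropping leading letters.
  quasiAt-ascent : ∀ {X : Tuple n (suc m)} {i} → QuasiAt X i → ¬ Descent (lookup X (inject₁ i)) (lookup X (suc i))
  quasiAt-ascent {X = _ ∷ _ ∷ _} {zero}  (quasiAt (x<y ∷ _) X∉ l r) d = X∉ (inv-∷ x<y d l)
  quasiAt-ascent {X = _ ∷ X}     {suc i} q = quasiAt-ascent (quasiAt-tail q)

  quasiAt-parity : ∀ {X : Tuple n (suc m)} {i} → QuasiAt X i → ascentParity X ≡ isOdd (m ∸ suc (toℕ i))
  quasiAt-parity {X = _ ∷ _ ∷ X}     {zero}  q = parity-ascent X (quasiAt-ascent q)
  quasiAt-parity {X = _ ∷ _ ∷ X@(_ ∷ _)} {suc i} q =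
    trans (parity-descent X (quasiAt-descent q)) (quasiAt-parity (quasiAt-tail q))

  -- If `i` and `j` were not consecutive, every pair of neighbouring letters of `X` would survive in
  -- `face X i` or in `face X j`. All of them would be descents and `X` an inversion.
  adjacent : ∀ {X : Tuple n (suc m)} → Increasing X → X ∉ Inv w → ∀ {i j} → i Fin.< j →
             face X i ∈ Inv w → face X j ∈ Inv w → ∃ λ a → i ≡ inject₁ a × j ≡ suc a
  adjacent {X = x ∷ y ∷ X}     (x<y ∷ _)   X∉ {zero}  {suc zero}    _         l r = zero , refl , refl
  adjacent {X = x ∷ y ∷ z ∷ X} (x<y ∷ _)   X∉ {zero}  {suc (suc j)} _         l r =
    contradiction (inv-∷ x<y (inv-descent r) l) X∉
  adjacent {X = x ∷ y ∷ z ∷ X} (x<y ∷ inc) X∉ {suc i} {suc (suc j)} (s<s i<j) l r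
    with a , refl , refl ← adjacent inc (X∉ ∘ inv-∷ x<y (inv-descent r)) i<j (inv-tail l) (inv-tail r)
    = suc a , refl , refl

  -- A pair of letters that misses position `inject₁ i` or position `suc i` survives in one of the
  -- two inversion faces. Only the pair at these two positions is left to be the ascent.
  quasiInversion : ∀ {X : Tuple n (suc m)} {i} → QuasiAt X i → QuasiInversion w X
  quasiInversion {X = X} {i} q@(quasiAt inc _ l r) =
    inc , inject₁ i , suc i , (i<i+1 , quasiAt-ascent q ∘ inv-descent) , only
    where
    i<i+1 : inject₁ i Fin.< suc i
    i<i+1 = s≤s (ℕ.≤-reflexive (Fin.toℕ-inject₁ i))
    only : ∀ a b → NonInvPair w X a b → a ≡ inject₁ i × b ≡ suc i
    only a b (a<b , X∉) with inject₁ i Fin.≟ a | inject₁ i Fin.≟ b | suc i Fin.≟ a | suc i Fin.≟ b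
    ... | yes refl | _        | _        | yes refl = refl , refl
    ... | no i≢a   | no i≢b   | _        | _        = contradiction (inv-face-pair {X = X} l a<b i≢a i≢b) X∉
    ... | _        | _        | no i≢a   | no i≢b   = contradiction (inv-face-pair {X = X} r a<b i≢a i≢b) X∉
    ... | yes refl | _        | yes eq   | _        = contradiction (sym eq) (Fin.<⇒≢ i<i+1)
    ... | _        | yes refl | yes refl | _        = contradiction i<i+1 (ℕ.<-asym a<b)
    ... | _        | yes refl | _        | yes eq   = contradiction (sym eq) (Fin.<⇒≢ i<i+1)

  -- Any face other than these two still contains both letters of the ascent.
  meetsInvAt : ∀ {X : Tuple n (suc m)} {i} → QuasiAt X i → MeetsInvAt w X i
  meetsInvAt {X = X} {i} q@(quasiAt inc _ l r) = to , from
    where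
    to : ∀ {Y} → Packet X Y × Inv w Y → face X (inject₁ i) ≡ Y ⊎ face X (suc i) ≡ Y
    to (Y∈ , inv) with ∈-tabulate⁻ {f = face X} Y∈
    ... | j , refl with j Fin.≟ inject₁ i | j Fin.≟ suc i
    ...   | yes refl | _        = inj₁ refl
    ...   | _        | yes refl = inj₂ refl
    ...   | no j≢i   | no j≢i+1 = contradiction
      (inv-descent (inv-face-pair {X = X} inv (s≤s (ℕ.≤-reflexive (Fin.toℕ-inject₁ i))) j≢i j≢i+1)) (quasiAt-ascent q)
    from : ∀ {Y} → face X (inject₁ i) ≡ Y ⊎ face X (suc i) ≡ Y → Packet X Y × Inv w Y
    from (inj₁ refl) = face-∈ X (inject₁ i) , l
    from (inj₂ refl) = face-∈ X (suc i) , r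

  quasiAt⁺ : ∀ {X : Tuple n (suc m)} {i} → QuasiInversion w X → MeetsInvAt w X i → QuasiAt X i
  quasiAt⁺ (inc , a , b , (a<b , X∉) , _) (_ , from) =
    quasiAt inc (λ inv → X∉ (inv-pair inv a<b)) (proj₂ (from (inj₁ refl))) (proj₂ (from (inj₂ refl)))

-- The directions given by a consistent set do not alternate.

parity-isOdd : ∀ m → (isOdd m ≡ true × parity m ≡ 1ℙ) ⊎ (isOdd m ≡ false × parity m ≡ 0ℙ)
parity-isOdd 0             = inj₂ (refl , refl)
parity-isOdd 1             = inj₁ (refl , refl)
parity-isOdd (suc (suc m)) rewrite Bool.not-involutive (isOdd m) = parity-isOdd m

bool-split : ∀ b c → b ≡ c ⊎ b ≡ not c
bool-split true  true  = inj₁ refl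
bool-split true  false = inj₂ refl
bool-split false true  = inj₂ refl
bool-split false false = inj₁ refl

does-true⁻ : ∀ {A : Set} (a? : Dec A) → does a? ≡ true → A
does-true⁻ (yes a) _ = a

module _ {n : ℕ} (w : Permutation′ n) where

  private
    variable
      m   : ℕ
      x y z : Fin n
      X Y : Tuple n m

  inv-cons : {X : Tuple n (suc m)} → Increasing (x ∷ X) → Descent w x (head X) → Inv w X → Inv w (x ∷ X)
  inv-cons {X = _ ∷ _} (x<y ∷ _) d inv = inv-∷ w x<y d inv

  parity-cons : (X : Tuple n (suc m)) → Descent w x (head X) → ascentParity w (x ∷ X) ≡ ascentParity w X
  parity-cons (_ ∷ X) = parity-descent w X

  quasiAt-cons : ∀ {X : Tuple n (suc (suc m))} {i} → Increasing (x ∷ X) → Descent w x (head X) →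
                 Descent w x (head (face X (inject₁ i))) → QuasiAt w X i → QuasiAt w (x ∷ X) (suc i)
  quasiAt-cons {X = _ ∷ _ ∷ _} {i} inc d d′ (quasiAt _ X∉ l r) =
    quasiAt inc (X∉ ∘ inv-tail w) (inv-cons (increasing-face (suc (inject₁ i)) inc) d′ l)
      (inv-cons (increasing-face (suc (suc i)) inc) d r)

  -- The possible positions of the ascents of X when X_ab and X_ac are inversions, where the indices
  -- are those of a , suc b , suc c.

  data Shape (X : Tuple n (suc (suc m))) (a : Fin (suc (suc m))) (b c : Fin (suc m)) : Set where
    inversion : X ∈ Inv w → Shape X a b c
    quasiˡ : a ≡ inject₁ b → QuasiAt w X b → face X (suc c) ∉ Inv w →
             ascentParity w (face X (suc c)) ≡ not (ascentParity w X) → Shape X a b c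
    quasiʳ : ∀ i → b ≡ inject₁ i → c ≡ suc i → QuasiAt w X (suc i) → face X a ∉ Inv w →
             ascentParity w (face X a) ≡ ascentParity w X → Shape X a b c
    sameˡ  : face X a ∉ Inv w → face X (suc b) ∉ Inv w →
             ascentParity w (face X a) ≡ ascentParity w (face X (suc b)) → Shape X a b c
    sameʳ  : face X (suc b) ∉ Inv w → face X (suc c) ∉ Inv w →
             ascentParity w (face X (suc b)) ≡ ascentParity w (face X (suc c)) → Shape X a b c

  shape-cons : ∀ {X : Tuple n (suc (suc m))} {a b c} → Increasing (x ∷ X) → Descent w x (head X) →
               Descent w x (head (face X a)) → Shape X a b c → Shape (x ∷ X) (suc a) (suc b) (suc c)
  shape-cons inc d dₐ (inversion p) = inversion (inv-cons inc d p)
  shape-cons {X = X@(_ ∷ _ ∷ _)} {c = c} inc d dₐ (quasiˡ refl q X∉ eq) =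
    quasiˡ refl (quasiAt-cons inc d dₐ q) (X∉ ∘ inv-tail w)
      (trans (parity-cons (face X (suc c)) d) (trans eq (cong not (sym (parity-cons X d)))))
  shape-cons {X = X@(_ ∷ _ ∷ _)} {a} inc d dₐ (quasiʳ i refl refl q X∉ eq) =
    quasiʳ (suc i) refl refl (quasiAt-cons inc d d q) (X∉ ∘ inv-tail w)
      (trans (parity-cons (face X a) dₐ) (trans eq (sym (parity-cons X d))))
  shape-cons {X = X@(_ ∷ _ ∷ _)} {a} {b} inc d dₐ (sameˡ X∉ X∉′ eq) =
    sameˡ (X∉ ∘ inv-tail w) (X∉′ ∘ inv-tail w)
      (trans (parity-cons (face X a) dₐ) (trans eq (sym (parity-cons (face X (suc b)) d))))
  shape-cons {X = X@(_ ∷ _ ∷ _)} {b = b} {c} inc d dₐ (sameʳ X∉ X∉′ eq) =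
    sameʳ (X∉ ∘ inv-tail w) (X∉′ ∘ inv-tail w)
      (trans (parity-cons (face X (suc b)) d) (trans eq (sym (parity-cons (face X (suc c)) d))))

  -- Leading descents are stripped by induction until the first letter is the one at `a`, or until
  -- an ascent is met in front. A leading ascent with `a` positive must involve the letter at `a`,
  -- since its two letters would otherwise both occur in an inversion. When `a` is `zero`, the cases
  -- are whether `x`, `y` is a descent and, if so, where the tail fails to be an inversion.
  shape : ∀ {X : Tuple n (suc (suc m))} {a b c} → Increasing X → toℕ a ℕ.≤ toℕ b → b Fin.< c →
          face (face X a) b ∈ Inv w → face (face X a) c ∈ Inv w → Shape X a b c
  shape {X = x ∷ y ∷ z ∷ X} {zero} {b} {suc c} inc@(x<y ∷ incW@(y<z ∷ _)) _ b<c invb invc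
    with descent? w x y
  ... | yes x≻y with Inv? w (y ∷ z ∷ X)
  ...   | yes p = inversion (inv-∷ w x<y x≻y p)
  ...   | no X∉ with adjacent w incW X∉ b<c invb invc
  ...     | suc i , refl , refl =
    quasiʳ (suc i) refl refl (quasiAt-cons inc x≻y x≻y (quasiAt incW X∉ invb invc)) X∉
      (sym (parity-cons (y ∷ z ∷ X) x≻y))
  ...     | zero , refl , refl with descent? w x z
  ...       | yes x≻z =
      quasiʳ zero refl refl (quasiAt-cons inc x≻y x≻z (quasiAt incW X∉ invb invc)) X∉
        (sym (parity-cons (y ∷ z ∷ X) x≻y))
  -- The faces without `x` and without `y` start with the ascents `y`, `z` and `x`, `z`, followed by
  -- the same letters.
  ...       | no x⊁z  = sameˡ X∉ (x⊁z ∘ inv-descent w)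
    (trans (parity-ascent w X (quasiAt-ascent w {i = zero} (quasiAt incW X∉ invb invc))) (sym (parity-ascent w X x⊁z)))
  shape {X = x ∷ y ∷ z ∷ X} {zero} {suc b} {suc c} inc _ _ invb invc | no x⊁y =
    -- Both faces keep the leading ascent `x`, `y` and have equally many letters after it.
    sameʳ (x⊁y ∘ inv-descent w) (x⊁y ∘ inv-descent w)
      (trans (parity-ascent w (face (z ∷ X) b) x⊁y) (sym (parity-ascent w (face (z ∷ X) c) x⊁y)))
  shape {X = x ∷ y ∷ z ∷ X} {zero} {zero} {suc c} inc@(x<y ∷ (y<z ∷ _)) _ _ invb invc | no x⊁y
    with descent? w x z
  ... | no x⊁z  = sameʳ (x⊁z ∘ inv-descent w) (x⊁y ∘ inv-descent w)
    (trans (parity-ascent w X x⊁z) (sym (parity-ascent w (face (z ∷ X) c) x⊁y)))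
  -- Here `x`, `y` is the only ascent of the tuple. Removing a letter after it shortens the rest by
  -- one, which negates the parity.
  ... | yes x≻z = quasiˡ refl
    (quasiAt inc (x⊁y ∘ inv-descent w) (inv-∷ w y<z y≻z invb) (inv-∷ w (Fin.<-trans x<y y<z) x≻z invb))
    (x⊁y ∘ inv-descent w)
    (trans (parity-ascent w (face (z ∷ X) c) x⊁y)
      (trans (sym (Bool.not-involutive _)) (cong not (sym (parity-ascent w (z ∷ X) x⊁y)))))
    where
    y≻z : Descent w y z
    y≻z = ℕ.<-≤-trans x≻z (ℕ.≮⇒≥ x⊁y)
  shape {X = t ∷ y ∷ z ∷ u ∷ X} {suc a} {suc b} {suc (suc c)} inc (s≤s a≤b) (s<s b<c) invb invc
    with descent? w t y | subst (Inv w) (face-face-∷ t (y ∷ z ∷ u ∷ X) a b) invb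
       | subst (Inv w) (face-face-∷ t (y ∷ z ∷ u ∷ X) a (suc c)) invc
  ... | yes t≻y | invb′ | invc′ = shape-cons inc t≻y (head-descent a invc′)
    (shape (Linked.tail inc) a≤b b<c (inv-tail w invb′) (inv-tail w invc′))
    where
    head-descent : ∀ a → t ∷ face (face (y ∷ z ∷ u ∷ X) a) (suc c) ∈ Inv w → Descent w t (head (face (y ∷ z ∷ u ∷ X) a))
    head-descent zero    p = inv-descent w p
    head-descent (suc a) p = t≻y
  shape {X = t ∷ y ∷ z ∷ u ∷ X} {suc zero} {suc b} {suc (suc c)} inc _ _ _ _ | no t⊁y | _ | _ =
    sameʳ (t⊁y ∘ inv-descent w) (t⊁y ∘ inv-descent w)
      (trans (parity-ascent w (face (z ∷ u ∷ X) b) t⊁y) (sym (parity-ascent w (face (z ∷ u ∷ X) (suc c)) t⊁y)))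
  shape {X = t ∷ y ∷ z ∷ u ∷ X} {suc (suc a)} {suc b} {suc (suc c)} inc _ _ _ _ | no t⊁y | _ | invc′ =
    contradiction (inv-descent w (subst (λ V → t ∷ V ∈ Inv w) (face-∷ y (face (z ∷ u ∷ X) a) c) invc′)) t⊁y

  turn-by-parity : ∀ {A : Set} (R : Rel A 0ℓ) k {x y} → (parity k ≡ 1ℙ → R x y) → (parity k ≡ 0ℙ → R y x) →
                   turn (isOdd k) R x y
  turn-by-parity R k f g with isOdd k | parity-isOdd k
  ... | true  | inj₁ (_ , p) = f p
  ... | false | inj₂ (_ , p) = g p

  quasiAt-rel : ∀ {X : Tuple n (suc m)} {i} → QuasiAt w X i →
                turn (ascentParity w X) (QuasiRel w) (face X (inject₁ i)) (face X (suc i))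
  quasiAt-rel {m} {i = i} q rewrite quasiAt-parity w q =
    turn-by-parity (QuasiRel w) (m ∸ suc (toℕ i)) (odd i (quasiInversion w q) (meetsInvAt w q))
      (even i (quasiInversion w q) (meetsInvAt w q))

  prefix⁻ : ∀ {X : Tuple n (suc m)} {c j} → Increasing X → Prefix X c (face X j) → c ℕ.≤ toℕ j
  prefix⁻ {c = c} inc (i , c≤i , eq) = subst (λ i → c ℕ.≤ toℕ i) (sym (face-injective inc eq)) c≤i

  suffix⁻ : ∀ {X : Tuple n (suc m)} {c j} → Increasing X → Suffix X c (face X j) → toℕ j ℕ.< c
  suffix⁻ {c = c} inc (i , i<c , eq) = subst (λ i → toℕ i ℕ.< c) (sym (face-injective inc eq)) i<c

  module _ {R : Pred (Tuple n m) 0ℓ} (R? : Decidable R) where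

    -- In the convention of `turn`, `true` asks for the antilex order of the faces and `false` for
    -- the lex order. On a quasi-inversion this is the direction of its `QuasiRel`, by
    -- `quasiAt-rel`.
    orient : Tuple n m → Bool
    orient X = if does (Inv? w X) then does (R? X) else ascentParity w X

    orient-∈ : ∀ {X} → X ∈ Inv w → orient X ≡ does (R? X)
    orient-∈ {X} p rewrite dec-true (Inv? w X) p = refl

    orient-∉ : ∀ {X} → X ∉ Inv w → orient X ≡ ascentParity w X
    orient-∉ {X} p rewrite dec-false (Inv? w X) p = refl

    orient-true : ∀ {X} → X ∈ Inv w → X ∈ R → orient X ≡ true
    orient-true {X} p r = trans (orient-∈ p) (dec-true (R? X) r)

    orient-true⁻ : ∀ {X} → X ∈ Inv w → orient X ≡ true → X ∈ R
    orient-true⁻ {X} p e = does-true⁻ (R? X) (trans (sym (orient-∈ p)) e)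

    orient-false : ∀ {X} → X ∈ Inv w → X ∉ R → orient X ≡ false
    orient-false {X} p r = trans (orient-∈ p) (dec-false (R? X) r)

  module _ {R : Pred (Tuple n (suc m)) 0ℓ} (R? : Decidable R) (con : Consistent w R) where
    open Consistent con

    -- If the packet meets `R` in a prefix, a middle face in `R` forces the face at `k` into `R`,
    -- and a middle face outside `R` keeps the face at `i` out. For a suffix the roles of `i` and
    -- `k` are exchanged.
    consistent-packet : ∀ {X : Tuple n (suc (suc m))} → X ∈ Inv w → ∀ {i j k} → i Fin.< j → j Fin.< k →
      does (R? (face X i)) ≡ does (R? (face X j)) ⊎ does (R? (face X j)) ≡ does (R? (face X k))
    consistent-packet {X} p {i} {j} {k} i<j j<k with prefixOrSuffix p | R? (face X j)
    ... | inj₁ (c , ⊆pre , pre⊆) | yes r = inj₂ (sym (dec-true (R? _)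
      (proj₂ (pre⊆ (k , ℕ.≤-trans (prefix⁻ (proj₁ p) (⊆pre (face-∈ X j , r))) (ℕ.<⇒≤ j<k) , refl)))))
    ... | inj₂ (c , ⊆suf , suf⊆) | yes r = inj₁ (dec-true (R? _)
      (proj₂ (suf⊆ (i , ℕ.<-trans i<j (suffix⁻ (proj₁ p) (⊆suf (face-∈ X j , r))) , refl))))
    ... | inj₁ (c , ⊆pre , pre⊆) | no ¬r = inj₁ (dec-false (R? _) λ r →
      ¬r (proj₂ (pre⊆ (j , ℕ.≤-trans (prefix⁻ (proj₁ p) (⊆pre (face-∈ X i , r))) (ℕ.<⇒≤ i<j) , refl))))
    ... | inj₂ (c , ⊆suf , suf⊆) | no ¬r = inj₂ (sym (dec-false (R? _) λ r →
      ¬r (proj₂ (suf⊆ (j , ℕ.<-trans j<k (suffix⁻ (proj₁ p) (⊆suf (face-∈ X k , r))) , refl)))))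

    -- The lower ideal condition for both parities at once: for odd parity, membership in `R` passes
    -- from the later face to the earlier one; for even parity, non-membership does.
    consistent-quasi : ∀ {X : Tuple n (suc (suc m))} {i} → QuasiAt w X i →
      orient R? (face X (suc i)) ≡ ascentParity w X → orient R? (face X (inject₁ i)) ≡ ascentParity w X
    consistent-quasi {X} {i} q@(quasiAt _ _ l r) eq with ascentParity w X | quasiAt-rel q
    ... | true  | rel = orient-true R? l (lowerIdeal (return rel) (orient-true⁻ R? r eq))
    ... | false | rel = Bool.¬-not λ e →
      contradiction (trans (sym eq) (orient-true R? r (lowerIdeal (return rel) (orient-true⁻ R? l e)))) λ ()

    -- An inversion is settled by prefixes and suffixes, and two non-inversion faces of equal parity
    -- agree outright. If `X` is a quasi-inversion, the third face has a fixed direction, and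
    -- `consistent-quasi` excludes the one combination of the other two that would alternate with
    -- it.
    orient-coherent : ∀ {X : Tuple n (suc (suc m))} → Increasing X → ∀ {a b c} → toℕ a ℕ.≤ toℕ b → b Fin.< c →
      face (face X a) b ∈ Inv w → face (face X a) c ∈ Inv w →
      orient R? (face X a) ≡ orient R? (face X (suc b)) ⊎ orient R? (face X (suc b)) ≡ orient R? (face X (suc c))
    orient-coherent {X} inc {a} {b} {c} a≤b b<c p q with shape inc a≤b b<c p q
    ... | inversion r with consistent-packet {X} r (s≤s a≤b) (s<s b<c)
    ...   | inj₁ e = inj₁ (trans (orient-∈ R? (inv-face w _ r)) (trans e (sym (orient-∈ R? (inv-face w _ r)))))
    ...   | inj₂ e = inj₂ (trans (orient-∈ R? (inv-face w _ r)) (trans e (sym (orient-∈ R? (inv-face w _ r)))))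
    orient-coherent {X} inc {a} {b} {c} a≤b b<c p q | sameˡ X∉ X∉′ e =
      inj₁ (trans (orient-∉ R? X∉) (trans e (sym (orient-∉ R? X∉′))))
    orient-coherent {X} inc {a} {b} {c} a≤b b<c p q | sameʳ X∉ X∉′ e =
      inj₂ (trans (orient-∉ R? X∉) (trans e (sym (orient-∉ R? X∉′))))
    orient-coherent {X} inc {a} {b} {c} a≤b b<c p q | quasiˡ refl r X∉ e
      with bool-split (orient R? (face X (suc b))) (ascentParity w X)
    ... | inj₁ e′ = inj₁ (trans (consistent-quasi r e′) (sym e′))
    ... | inj₂ e′ = inj₂ (trans e′ (sym (trans (orient-∉ R? X∉) e)))
    orient-coherent {X} inc {a} {b} {c} a≤b b<c p q | quasiʳ i refl refl r X∉ e
      with bool-split (orient R? (face X (suc (suc i)))) (ascentParity w X)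
         | bool-split (orient R? (face X (inject₁ (suc i)))) (ascentParity w X)
    ... | _ | inj₁ e′ = inj₁ (trans (trans (orient-∉ R? X∉) e) (sym e′))
    ... | inj₁ e″ | inj₂ e′ = inj₁ (trans (trans (orient-∉ R? X∉) e) (sym (consistent-quasi r e″)))
    ... | inj₂ e″ | inj₂ e′ = inj₂ (trans e′ (sym e″))

-- Increasing tuples as sublists of the list of all letters.

∈-tail : ∀ {n} {x : Fin n} {ls y} → x Fin.< y → y List.∈ (x ∷ ls) → y List.∈ ls
∈-tail x<y (here refl) = contradiction refl (Fin.<⇒≢ x<y)
∈-tail x<y (there p)   = p

increasing⇒All : ∀ {n m} {x} {X : Tuple n m} → Increasing (x ∷ X) → All (x Fin.<_) (toList X)
increasing⇒All [-]                  = []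
increasing⇒All {X = _ ∷ _} (r ∷ rs) = r ∷ All.map (Fin.<-trans r) (increasing⇒All rs)

increasing⇒⊑ : ∀ {n m} {ls : List (Fin n)} → AllPairs Fin._<_ ls → {X : Tuple n m} → Increasing X →
               All (List._∈ ls) (toList X) → toList X ⊑ ls
increasing⇒⊑ _ {[]} _ _ = minimum _
increasing⇒⊑ [] {x ∷ X} _ (() ∷ _)
increasing⇒⊑ (l< ∷ sorted) {x ∷ X} inc (here refl ∷ X∈) =
  refl ∷ increasing⇒⊑ sorted (Linked.tail inc) (All.zipWith (λ (lt , p) → ∈-tail lt p) (increasing⇒All inc , X∈))
increasing⇒⊑ (l< ∷ sorted) {x ∷ X} inc (there x∈ ∷ X∈) =
  _ ∷ʳ increasing⇒⊑ sorted inc (x∈ ∷ All.zipWith (λ (lt , p) → ∈-tail (Fin.<-trans (All.lookup l< x∈) lt) p)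
    (increasing⇒All inc , X∈))

⊑⇒AllPairs : ∀ {A : Set} {R : Rel A 0ℓ} {xs ys : List A} → xs ⊑ ys → AllPairs R ys → AllPairs R xs
⊑⇒AllPairs []         _        = []
⊑⇒AllPairs (_ ∷ʳ p)   (_ ∷ rs) = ⊑⇒AllPairs p rs
⊑⇒AllPairs (refl ∷ p) (r ∷ rs) = All-resp-⊆ p r ∷ ⊑⇒AllPairs p rs

AllPairs⇒increasing : ∀ {n m} {X : Tuple n m} → AllPairs Fin._<_ (toList X) → Increasing X
AllPairs⇒increasing {X = []}        _                = []
AllPairs⇒increasing {X = _ ∷ []}    _                = [-]
AllPairs⇒increasing {X = _ ∷ _ ∷ _} ((r ∷ _) ∷ rs) = r ∷ AllPairs⇒increasing rs

allFin-sorted : ∀ n → AllPairs Fin._<_ (allFin n)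
allFin-sorted n = AllPairs.tabulate⁺-< (λ i<j → i<j)

increasing⇒⊑allFin : ∀ {n m} {X : Tuple n m} → Increasing X → toList X ⊑ allFin n
increasing⇒⊑allFin {n} inc = increasing⇒⊑ (allFin-sorted n) inc (All.universal ∈-allFin _)

⊑allFin⇒increasing : ∀ {n m} {X : Tuple n m} → toList X ⊑ allFin n → Increasing X
⊑allFin⇒increasing {n} p = AllPairs⇒increasing (⊑⇒AllPairs p (allFin-sorted n))

-- Directions and closures inside a linear order.

Unique-resp-↭ : ∀ {A : Set} {xs ys : List A} → xs ↭ ys → Unique xs → Unique ys
Unique-resp-↭ {A} p = ↭ₛ.Unique-resp-↭ (setoid A) (↭⇒↭ₛ p)

turn-map : ∀ {A : Set} {R S : Rel A 0ℓ} s {x y} → (R x y → S x y) → (R y x → S y x) → turn s R x y → turn s S x y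
turn-map true  f g = f
turn-map false f g = g

turn-≡ : ∀ {A : Set} {R : Rel A 0ℓ} {s t x y} → s ≡ t → turn t R x y → turn s R x y
turn-≡ refl r = r

-- The two alternating patterns of directions are the two 3-cycles on `x`, `y`, `z`, which no linear
-- order contains.
turn-acyclic : ∀ {A : Set} {xs : List A} {x y z} → Unique xs → ∀ s t u → turn s (Before xs) x y →
               turn t (Before xs) x z → turn u (Before xs) y z → s ≡ t ⊎ t ≡ u
turn-acyclic un true  true  _     _ _ _ = inj₁ refl
turn-acyclic un false false _     _ _ _ = inj₁ refl
turn-acyclic un true  false false _ _ _ = inj₂ refl
turn-acyclic un false true  true  _ _ _ = inj₂ refl
turn-acyclic un true  false true  p q r = contradiction q (before-asym un (before-trans un p r))
turn-acyclic un false true  false p q r = contradiction q (before-asym un (before-trans un r p))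

star-before : ∀ {A : Set} {E : Rel A 0ℓ} {xs : List A} → Unique xs → (∀ {x y} → E x y → Before xs x y) →
              ∀ {x y} → Star E x y → x ≡ y ⊎ Before xs x y
star-before u f ε = inj₁ refl
star-before u f (e ◅ es) with star-before u f es
... | inj₁ refl = inj₂ (f e)
... | inj₂ b    = inj₂ (before-trans u (f e) b)

ascending : ∀ {A : Set} {R : Rel A 0ℓ} → (∀ x → R x x) → (∀ {x y z} → R x y → R y z → R x z) →
            ∀ {m} (f : Fin (suc m) → A) → (∀ i → R (f (inject₁ i)) (f (suc i))) → ∀ i j → i Fin.≤ j → R (f i) (f j)
ascending rf tr f step zero zero _ = rf (f zero)
ascending {R = R} rf tr {suc m} f step zero (suc j) _ =
  tr (step zero) (ascending {R = R} rf tr (f ∘ suc) (step ∘ suc) zero j z≤n)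
ascending {R = R} rf tr {suc m} f step (suc i) (suc j) (s≤s i≤j) =
  ascending {R = R} rf tr (f ∘ suc) (step ∘ suc) i j i≤j

inject₁<suc : ∀ {m} (i : Fin m) → inject₁ i Fin.< suc i
inject₁<suc i = s≤s (ℕ.≤-reflexive (Fin.toℕ-inject₁ i))

isOdd-1ℙ : ∀ m → parity m ≡ 1ℙ → isOdd m ≡ true
isOdd-1ℙ m eq with parity-isOdd m
... | inj₁ (e , _) = e
... | inj₂ (_ , e) = contradiction (trans (sym e) eq) λ ()

isOdd-0ℙ : ∀ m → parity m ≡ 0ℙ → isOdd m ≡ false
isOdd-0ℙ m eq with parity-isOdd m
... | inj₁ (_ , e) = contradiction (trans (sym e) eq) λ ()
... | inj₂ (e , _) = e

-- Tuples determined by their letters, and packets sharing faces.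

module _ {n : ℕ} where

  head-< : ∀ {m} {X : Tuple n (suc m)} → Increasing X → ∀ j → head X Fin.< lookup X (suc j)
  head-< {X = _ ∷ _} inc j = Linked.lookup⁺ Fin.<-trans inc z<s

  -- Each head is the least letter of its tuple, so equal letter sets have equal heads, and the
  -- tails again have equal letter sets.
  increasing-ext : ∀ {m} {X Y : Tuple n m} → Increasing X → Increasing Y →
    (∀ i → ∃ λ j → lookup X i ≡ lookup Y j) → (∀ i → ∃ λ j → lookup Y i ≡ lookup X j) → X ≡ Y
  increasing-ext {X = []} {[]} _ _ _ _ = refl
  increasing-ext {X = x ∷ X} {y ∷ Y} incX incY f g =
    cong₂ _∷_ x≡y (increasing-ext (Linked.tail incX) (Linked.tail incY) f′ g′)
    where
    x≡y : x ≡ y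
    x≡y with f zero | g zero
    ... | zero  , eq | _ = eq
    ... | suc j , eq | zero , eq′ = sym eq′
    ... | suc j , eq | suc i , eq′ = contradiction (Fin.<-trans (head-< incX i)
          (subst (Fin._< x) eq′ (subst (y Fin.<_) (sym eq) (head-< incY j)))) (Fin.<-irrefl refl)
    f′ : ∀ i → ∃ λ j → lookup X i ≡ lookup Y j
    f′ i with f (suc i)
    ... | suc j , eq = j , eq
    ... | zero  , eq = contradiction (trans x≡y (sym eq)) (Fin.<⇒≢ (head-< incX i))
    g′ : ∀ i → ∃ λ j → lookup Y i ≡ lookup X j
    g′ i with g (suc i)
    ... | suc j , eq = j , eq
    ... | zero  , eq = contradiction (trans (sym x≡y) (sym eq)) (Fin.<⇒≢ (head-< incY i))

  lookup-face : ∀ {m} (X : Tuple n (suc m)) i j → ∃ λ k → lookup (face X i) j ≡ lookup X k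
  lookup-face (x ∷ X)     zero    j       = suc j , refl
  lookup-face (x ∷ y ∷ X) (suc i) zero    = zero , refl
  lookup-face (x ∷ y ∷ X) (suc i) (suc j) = let k , eq = lookup-face (y ∷ X) i j in suc k , eq

  -- Only the letter at `i` is missing from `face X i`, and it is present in `face X j`.
  faces-cover : ∀ {m} (X Y : Tuple n (suc m)) {i j a b} → i ≢ j → face X i ≡ face Y a → face X j ≡ face Y b →
                ∀ p → ∃ λ q → lookup X p ≡ lookup Y q
  faces-cover X Y {i} {j} {a} {b} i≢j eq eq′ p with i Fin.≟ p
  ... | no i≢p = let q , e = lookup-face Y a (punchOut i≢p) in
    q , trans (sym (removeAt-punchOut X i≢p)) (trans (cong (λ V → lookup V (punchOut i≢p)) eq) e)
  ... | yes refl = let q , e = lookup-face Y b (punchOut (i≢j ∘ sym)) in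
    q , trans (sym (removeAt-punchOut X (i≢j ∘ sym))) (trans (cong (λ V → lookup V (punchOut (i≢j ∘ sym))) eq′) e)

  -- Two distinct faces have the whole set as their union, so a common pair of faces gives `X` and
  -- `Y` the same letters.
  packet-unique : ∀ {m} {X Y : Tuple n (suc m)} → Increasing X → Increasing Y → ∀ {i j} → i ≢ j →
                  face X i ∈ Packet Y → face X j ∈ Packet Y → X ≡ Y
  packet-unique {X = X} {Y} incX incY i≢j p q with ∈-tabulate⁻ {f = face Y} p | ∈-tabulate⁻ {f = face Y} q
  ... | a , eq | b , eq′ = increasing-ext incX incY (faces-cover X Y i≢j eq eq′)
    (faces-cover Y X {a} {b} (λ { refl → i≢j (face-injective incX (trans eq (sym eq′))) }) (sym eq) (sym eq′))

  antilex-unique : ∀ {m} {X : Tuple n (suc m)} → Increasing X → Unique (antilex X)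
  antilex-unique inc = Unique.tabulate⁺ (face-injective inc)

  lex-unique : ∀ {m} {X : Tuple n (suc m)} → Increasing X → Unique (lex X)
  lex-unique {X = X} inc = Unique-resp-↭ (↭-sym (↭-reverse (antilex X))) (antilex-unique inc)

  -- The length `suc (suc m)` provides two faces, which the two lists put in opposite order.
  lex≢antilex : ∀ {m} {X : Tuple n (suc (suc m))} → Increasing X → lex X ≢ antilex X
  lex≢antilex {X = X} inc eq = before-asym (lex-unique inc)
    (before-reverse⁺ first) (subst (λ xs → Before xs (face X zero) (face X (suc zero))) (sym eq) first)
    where
    first : Before (antilex X) (face X zero) (face X (suc zero))
    first = before-tabulate⁺ (face X) {zero} {suc zero} z<s

-- Orders following the directions of a set; comparison with linear extensions and with admissible
-- orders.

module _ {n : ℕ} (w : Permutation′ n) where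

  private
    variable
      k m : ℕ

  Oriented : List (Tuple n k) → (Tuple n (suc k) → Bool) → Set
  Oriented ρ d = ∀ {Z} → Increasing Z → ∀ {i j} → i Fin.< j → face Z i ∈ Inv w → face Z j ∈ Inv w →
                 turn (d Z) (Before ρ) (face Z i) (face Z j)

  -- The common form of the linear extensions of the order given by `R` and of the members of `𝒜`
  -- with reversal set `R`. Here `R` is any decidable predicate, so that consistency can appear as a
  -- conclusion in `realises⇒consistent`.
  record Realises {R : Pred (Tuple n (suc k)) 0ℓ} (R? : Decidable R) (ρ : List (Tuple n k)) : Set where
    constructor realises
    field
      total    : IsTotalOrderOn (Inv w) ρ
      oriented : Oriented ρ (orient w R?)
    unique : Unique ρ
    unique = proj₁ total
    ∈-inv : ∀ {X} → X ∈ Inv w → X List.∈ ρ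
    ∈-inv = Equivalence.from (proj₂ total _)
    inv-∈ : ∀ {X} → X List.∈ ρ → X ∈ Inv w
    inv-∈ = Equivalence.to (proj₂ total _)

  -- Coherence of `orient` is what `arrange` over all letters requires. This is where every
  -- consistent set acquires an order.
  realisation : {R : Pred (Tuple n (suc k)) 0ℓ} (R? : Decidable R) → Consistent w R → ∃ (Realises R?)
  realisation {k} {R} R? con = arrange (allFin n) (Inv? w) (orient w R?) , realises
    (arrange-unique (allFin n) (Inv? w) _ (Unique.allFin⁺ n) ,
     λ X → mk⇔ (proj₂ ∘ ∈-arrange⁻ (allFin n) (Inv? w) _)
               (λ p → ∈-arrange⁺ (allFin n) (Inv? w) _ (increasing⇒⊑allFin (proj₁ p)) p))
    (λ inc → arrange-oriented (allFin n) (Inv? w) (orient w R?) coherent (increasing⇒⊑allFin inc))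
    where
    coherent : Coherent (allFin n) (Inv w) (orient w R?)
    coherent p = orient-coherent w R? con (⊑allFin⇒increasing p)

  quasi-before : {R : Pred (Tuple n (suc k)) 0ℓ} (R? : Decidable R) → ∀ {ρ} → Oriented ρ (orient w R?) →
                 ∀ {X Y} → QuasiRel w X Y → Before ρ X Y
  quasi-before {k} R? {ρ} o (odd {X} i qi meets par) =
    turn-≡ (sym dir) (o inc (inject₁<suc i) l r)
    where
    q = quasiAt⁺ w qi meets
    open QuasiAt q using () renaming (increasing to inc; invˡ to l; invʳ to r)
    dir : orient w R? X ≡ true
    dir = trans (orient-∉ w R? (QuasiAt.∉Inv q)) (trans (quasiAt-parity w q) (isOdd-1ℙ (k ∸ suc (toℕ i)) par))
  quasi-before {k} R? {ρ} o (even {X} i qi meets par) =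
    turn-≡ (sym dir) (o inc (inject₁<suc i) l r)
    where
    q = quasiAt⁺ w qi meets
    open QuasiAt q using () renaming (increasing to inc; invˡ to l; invʳ to r)
    dir : orient w R? X ≡ false
    dir = trans (orient-∉ w R? (QuasiAt.∉Inv q)) (trans (quasiAt-parity w q) (isOdd-0ℙ (k ∸ suc (toℕ i)) par))

  -- A `Z` outside `Inv` with two faces in `Inv` is a quasi-inversion with these faces consecutive,
  -- by `adjacent`. The three conditions therefore cover every pair that `Oriented` speaks of.
  realises-intro : {R : Pred (Tuple n (suc k)) 0ℓ} (R? : Decidable R) → ∀ {ρ} → IsTotalOrderOn (Inv w) ρ →
    (∀ {X Y} → QuasiRel w X Y → X ≢ Y → Before ρ X Y) →
    (∀ {X} → X ∈ Inv w → X ∈ R → ∀ {i j} → i Fin.< j → Before ρ (face X i) (face X j)) →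
    (∀ {X} → X ∈ Inv w → X ∉ R → ∀ {i j} → i Fin.< j → Before ρ (face X j) (face X i)) →
    Realises R? ρ
  realises-intro {R = R} R? {ρ} total onQuasi onR off = realises total o
    where
    o : Oriented ρ (orient w R?)
    o {Z} inc {i} {j} i<j l r = by-cases (Inv? w Z) (R? Z)
      where
      by-cases : Dec (Z ∈ Inv w) → Dec (Z ∈ R) → turn (orient w R? Z) (Before ρ) (face Z i) (face Z j)
      by-cases (yes Z∈) (yes p) = turn-≡ (orient-true w R? Z∈ p) (onR Z∈ p i<j)
      by-cases (yes Z∈) (no ¬p) = turn-≡ (orient-false w R? Z∈ ¬p) (off Z∈ ¬p i<j)
      by-cases (no Z∉)  _ with adjacent w inc Z∉ i<j l r
      ... | a , refl , refl = turn-≡ (orient-∉ w R? Z∉)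
        (turn-map (ascentParity w Z) (λ q → onQuasi q (face-≢ inc i<j)) (λ q → onQuasi q (face-≢ inc i<j ∘ sym))
          (quasiAt-rel w (quasiAt inc Z∉ l r)))

  ℒ⇒realises : ∀ (R : 𝒞 w (suc k)) {ρ} → ℒ w R ρ → Realises (𝒞.set? R) ρ
  ℒ⇒realises {k} R {ρ} (total , ext) = realises-intro (𝒞.set? R) total (λ q → ext (return (quasi q)))
    (λ {X} _ p {i} {j} i<j →
      ext (ascending {R = _⟶*_} (λ _ → ε) _◅◅_ (face X) (λ i → return (inside i p)) i j (ℕ.<⇒≤ i<j))
          (face-≢ (proj₁ (R⊆Inv p)) i<j))
    (λ {X} X∈ ¬p {i} {j} i<j →
      ext (ascending {R = flip′ _⟶*_} (λ _ → ε) (flip′ _◅◅_) (face X)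
             (λ i → return (beyond i (X∈ , ¬p))) i j (ℕ.<⇒≤ i<j))
          (face-≢ (proj₁ X∈) i<j ∘ sym))
    where
    open Consistent (𝒞.consistent R)
    _⟶*_ : Rel (Tuple n k) 0ℓ
    _⟶*_ = Star (Edge w (𝒞.set R))

  realises⇒ℒ : ∀ (R : 𝒞 w (suc k)) {ρ} → Realises (𝒞.set? R) ρ → ℒ w R ρ
  realises⇒ℒ {k} R {ρ} re = total , λ es X≢Y → fromInj₂ (λ eq → contradiction eq X≢Y) (star-before unique edge es)
    where
    open Realises re
    open Consistent (𝒞.consistent R)
    edge : ∀ {X Y} → Edge w (𝒞.set R) X Y → Before ρ X Y
    edge (quasi q) = quasi-before (𝒞.set? R) oriented q
    edge (inside {X} i p) = turn-≡ (sym (orient-true w (𝒞.set? R) (R⊆Inv p) p))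
      (oriented (proj₁ (R⊆Inv p)) (inject₁<suc i) (inv-face w _ (R⊆Inv p)) (inv-face w _ (R⊆Inv p)))
    edge (beyond {X} i (X∈ , ¬p)) = turn-≡ (sym (orient-false w (𝒞.set? R) X∈ ¬p))
      (oriented (proj₁ X∈) (inject₁<suc i) (inv-face w _ X∈) (inv-face w _ X∈))

  -- The restriction to a packet is a sublist of `ρ`, so its order is the order in `ρ`.
  -- Admissibility makes it lex when it is not antilex.
  𝒜⇒realises : ∀ {ρ : List (Tuple n k)} → 𝒜 w k ρ → Realises (Rev? w ρ) ρ
  𝒜⇒realises {k} {ρ} a = realises-intro (Rev? w ρ) (proj₁ linearExtension) (λ q → proj₂ linearExtension (return q))
    (λ {X} X∈ p i<j → before-filter⁻ _ ρ (subst (λ xs → Before xs _ _) (sym (proj₂ p)) (before-tabulate⁺ (face X) i<j)))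
    λ {X} X∈ ¬p i<j → before-filter⁻ _ ρ (subst (λ xs → Before xs _ _) (sym (fromInj₁ (λ eq → contradiction (X∈ , eq) ¬p) (admissible X∈)))
      (before-reverse⁺ (before-tabulate⁺ (face X) i<j)))
    where open 𝒜 a

  packet-inv : ∀ {X : Tuple n (suc k)} {Y} → X ∈ Inv w → Packet X Y → Y ∈ Inv w
  packet-inv {X = X} X∈ p with _ , refl ← ∈-tabulate⁻ {f = face X} p = inv-face w _ X∈

  module _ {R : Pred (Tuple n (suc k)) 0ℓ} (R? : Decidable R) {ρ : List (Tuple n k)} (re : Realises R? ρ) where
    open Realises re

    before-∈ : ∀ {X} → X ∈ Inv w → X ∈ R → ∀ {i j} → i Fin.< j → Before ρ (face X i) (face X j)
    before-∈ {X} X∈ p {i} {j} i<j = turn-≡ (sym (orient-true w R? X∈ p))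
      (oriented (proj₁ X∈) i<j (inv-face w _ X∈) (inv-face w _ X∈))

    before-∉ : ∀ {X} → X ∈ Inv w → X ∉ R → ∀ {i j} → i Fin.< j → Before ρ (face X j) (face X i)
    before-∉ {X} X∈ p {i} {j} i<j = turn-≡ (sym (orient-false w R? X∈ p))
      (oriented (proj₁ X∈) i<j (inv-face w _ X∈) (inv-face w _ X∈))

    packet-∈ : ∀ {X} → X ∈ Inv w → X ∈ R → ρ ∣ X ≡ antilex X
    packet-∈ {X} X∈ p =
      before-ext (Unique.filter⁺ _ unique) (antilex-unique (proj₁ X∈)) (λ z∈ → proj₂ (∈-filter⁻ _ {xs = ρ} z∈))
      (λ z∈ → ∈-filter⁺ _ (∈-inv (packet-inv X∈ z∈)) z∈) opposite
      where
      opposite : ∀ {x y} → Before (ρ ∣ X) x y → ¬ Before (antilex X) y x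
      opposite b b′ with _ , _ , i<j , refl , refl ← before-tabulate⁻ (face X) b′ =
        before-asym unique (before-filter⁻ _ ρ b) (before-∈ X∈ p i<j)

    packet-∉ : ∀ {X} → X ∈ Inv w → X ∉ R → ρ ∣ X ≡ lex X
    packet-∉ {X} X∈ p = before-ext (Unique.filter⁺ _ unique) (lex-unique (proj₁ X∈))
      (λ z∈ → ∈-resp-↭ (↭-sym (↭-reverse (antilex X))) (proj₂ (∈-filter⁻ _ {xs = ρ} z∈)))
      (λ z∈ → let z∈′ = ∈-resp-↭ (↭-reverse (antilex X)) z∈ in ∈-filter⁺ _ (∈-inv (packet-inv X∈ z∈′)) z∈′)
      opposite
      where
      opposite : ∀ {x y} → Before (ρ ∣ X) x y → ¬ Before (lex X) y x
      opposite b b′ with _ , _ , i<j , refl , refl ← before-tabulate⁻ (face X) (before-reverse⁻ b′) =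
        before-asym unique (before-filter⁻ _ ρ b) (before-∉ X∈ p i<j)

    realises⇒𝒜 : 𝒜 w k ρ
    realises⇒𝒜 = record
      { linearExtension = total , λ es X≢Y → fromInj₂ (λ eq → contradiction eq X≢Y)
        (star-before unique (quasi-before R? oriented) es)
      ; admissible = adm
      }
      where
      adm : ∀ {X} → X ∈ Inv w → ρ ∣ X ≡ lex X ⊎ ρ ∣ X ≡ antilex X
      adm {X} X∈ with R? X
      ... | yes p = inj₂ (packet-∈ X∈ p)
      ... | no ¬p = inj₁ (packet-∉ X∈ ¬p)

  realises⇒Rev : {R : Pred (Tuple n (suc (suc k))) 0ℓ} (R? : Decidable R) → R ⊆ Inv w → ∀ {ρ} → Realises R? ρ →
    Rev w ρ ≐ R
  realises⇒Rev {k} {R} R? R⊆Inv {ρ} re = to , λ p → R⊆Inv p , packet-∈ R? re (R⊆Inv p) p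
    where
    to : Rev w ρ ⊆ R
    to {X} (X∈ , eq) with R? X
    ... | yes p = p
    ... | no ¬p = contradiction (trans (sym (packet-∉ R? re X∈ ¬p)) eq) (lex≢antilex (proj₁ X∈))

-- A set followed by some order is consistent.

below : ∀ {m} {i j : Fin (suc m)} → i Fin.< j → ∃₂ λ a b → i ≡ inject₁ a × j ≡ suc b × a Fin.≤ b
below {suc m} {zero}  {suc b} _         = zero , b , refl , refl , z≤n
below {suc m} {suc i} {suc j} (s<s i<j) with a , b , refl , refl , a≤b ← below i<j =
  suc a , suc b , refl , refl , s≤s a≤b

initial-segment : ∀ {m} (f : Fin m → Bool) → (∀ {i j} → i Fin.< j → f i ≡ false → f j ≡ false) →
                  ∃ λ c → (∀ {i} → f i ≡ true → toℕ i ℕ.< c) × (∀ {i} → toℕ i ℕ.< c → f i ≡ true)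
initial-segment {zero}  f down = 0 , (λ {}) , λ {}
initial-segment {suc m} f down with f zero in eq
... | false = 0 , (λ {i} e → contradiction (trans (sym e) (all-false i)) λ ()) , λ ()
  where
  all-false : ∀ i → f i ≡ false
  all-false zero    = eq
  all-false (suc i) = down z<s eq
... | true with c , to , from ← initial-segment (f ∘ suc) (λ i<j → down (s<s i<j)) = suc c , to′ , from′
  where
  to′ : ∀ {i} → f i ≡ true → toℕ i ℕ.< suc c
  to′ {zero}  _ = z<s
  to′ {suc i} e = s<s (to e)
  from′ : ∀ {i} → toℕ i ℕ.< suc c → f i ≡ true
  from′ {zero}  _         = eq
  from′ {suc i} (s<s i<c) = from i<c

-- Comparing with the value at `zero`, once another value occurs it persists: a return would
-- alternate. So the true indices form an initial segment if `f zero` is true, and a final one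
-- otherwise.
nonalternating-segments : ∀ {m} (f : Fin m → Bool) → (∀ {i j k} → i Fin.< j → j Fin.< k → f i ≡ f j ⊎ f j ≡ f k) →
  (∃ λ c → (∀ {i} → f i ≡ true → c ℕ.≤ toℕ i) × (∀ {i} → c ℕ.≤ toℕ i → f i ≡ true)) ⊎
  (∃ λ c → (∀ {i} → f i ≡ true → toℕ i ℕ.< c) × (∀ {i} → toℕ i ℕ.< c → f i ≡ true))
nonalternating-segments {zero}  f alt = inj₁ (0 , (λ {}) , λ {})
nonalternating-segments {suc m} f alt with f zero in eq
... | true = inj₂ (initial-segment f down)
  where
  down : ∀ {i j} → i Fin.< j → f i ≡ false → f j ≡ false
  down {zero}  i<j e = contradiction (trans (sym eq) e) λ ()
  down {suc i} i<j e with alt {zero} {suc i} z<s i<j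
  ... | inj₁ e′ = contradiction (trans (sym eq) (trans e′ e)) λ ()
  ... | inj₂ e′ = trans (sym e′) e
... | false = let c , to , from = initial-segment (not ∘ f) down in
  inj₁ (c , (λ {i} e → ℕ.≮⇒≥ λ i<c → contradiction (trans (cong not (sym e)) (from i<c)) λ ()) ,
        λ {i} c≤i → trans (sym (Bool.not-involutive (f i))) (cong not (Bool.¬-not λ e → ℕ.<⇒≱ (to e) c≤i)))
  where
  down : ∀ {i j} → i Fin.< j → not (f i) ≡ false → not (f j) ≡ false
  down {zero}  i<j e = contradiction (trans (cong not (sym eq)) e) λ ()
  down {suc i} i<j e with alt {zero} {suc i} z<s i<j
  ... | inj₁ e′ = contradiction (trans (cong not (trans (sym eq) e′)) e) λ ()
  ... | inj₂ e′ = trans (cong not (sym e′)) e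

module _ {n : ℕ} (w : Permutation′ n) where

  private
    variable
      k m : ℕ

  module _ {R : Pred (Tuple n (suc k)) 0ℓ} (R? : Decidable R) {ρ : List (Tuple n k)} (re : Realises w R? ρ) where
    open Realises re

    -- The three faces orient the three pairs among the double faces `X_ab`, `X_ac`, `X_bc`, and an
    -- alternation would be a 3-cycle in `ρ`. The middle index is written both as `suc b` and as
    -- `inject₁ b′`, so that `face-face` can identify the double faces on either side.
    realises-triple : ∀ {X : Tuple n (suc (suc k))} {a b b′ c} → Increasing X → a Fin.≤ b → suc b ≡ inject₁ b′ →
      b′ Fin.≤ c →
      face (face X (suc b)) a ∈ Inv w → face (face X (inject₁ a)) c ∈ Inv w → face (face X (suc b)) c ∈ Inv w →
      orient w R? (face X (inject₁ a)) ≡ orient w R? (face X (suc b)) ⊎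
      orient w R? (face X (suc b)) ≡ orient w R? (face X (suc c))
    realises-triple {X} {a} {b} {b′} {c} inc a≤b b+1≡b′ b′≤c ab ac bc =
      turn-acyclic unique (d (face X (inject₁ a))) (d (face X (suc b))) (d (face X (suc c))) o₁ o₂ o₃
      where
      d = orient w R?
      b<c : b Fin.< c
      b<c = subst (ℕ._≤ toℕ c) (trans (sym (Fin.toℕ-inject₁ b′)) (cong toℕ (sym b+1≡b′))) b′≤c
      a<b′ : a Fin.< b′
      a<b′ = ℕ.<-≤-trans (s≤s a≤b) (ℕ.≤-reflexive (trans (cong toℕ b+1≡b′) (Fin.toℕ-inject₁ b′)))
      o₁ : turn (d (face X (inject₁ a))) (Before ρ) (face (face X (suc b)) a) (face (face X (inject₁ a)) c)
      o₁ = subst (λ V → turn (d (face X (inject₁ a))) (Before ρ) V (face (face X (inject₁ a)) c))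
             (sym (face-face X a≤b))
             (oriented (increasing-face (inject₁ a) inc) b<c (subst (Inv w) (face-face X a≤b) ab) ac)
      o₂ : turn (d (face X (suc b))) (Before ρ) (face (face X (suc b)) a) (face (face X (suc b)) c)
      o₂ = oriented (increasing-face (suc b) inc) (ℕ.≤-<-trans a≤b b<c) ab bc
      eq₁ : face (face X (suc c)) a ≡ face (face X (inject₁ a)) c
      eq₁ = face-face X (ℕ.≤-trans a≤b (ℕ.<⇒≤ b<c))
      eq₂ : face (face X (suc c)) b′ ≡ face (face X (suc b)) c
      eq₂ = trans (face-face X b′≤c) (cong (λ i → face (face X i) c) (sym b+1≡b′))
      o₃ : turn (d (face X (suc c))) (Before ρ) (face (face X (inject₁ a)) c) (face (face X (suc b)) c)
      o₃ = subst₂ (turn (d (face X (suc c))) (Before ρ)) eq₁ eq₂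
             (oriented (increasing-face (suc c) inc) a<b′ (subst (Inv w) (sym eq₁) ac) (subst (Inv w) (sym eq₂) bc))

  -- Two faces are compared with a third that keeps the ascent, so that its direction is known. If
  -- the ascent is not at the front, the first letter is removed and the parity is unchanged. If it
  -- is at the front, the third letter is removed and the parity is negated.
  realises-quasi : ∀ {R : Pred (Tuple n (suc (suc k))) 0ℓ} (R? : Decidable R) {ρ : List (Tuple n (suc k))} →
    Realises w R? ρ →
    ∀ {X : Tuple n (suc (suc (suc k)))} {i} → QuasiAt w X i →
    orient w R? (face X (suc i)) ≡ ascentParity w X → orient w R? (face X (inject₁ i)) ≡ ascentParity w X
  realises-quasi R? re {X@(x ∷ Y@(_ ∷ _ ∷ _))} {suc i} q eq
    with realises-triple R? re {X} {zero} {inject₁ i} {suc i} {suc i} (QuasiAt.increasing q) z≤n refl ℕ.≤-refl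
           (inv-face w zero (QuasiAt.invˡ q))
           (subst (Inv w) (face-face X {zero} {suc i} z≤n) (inv-face w zero (QuasiAt.invʳ q)))
           (inv-face w (suc i) (QuasiAt.invˡ q))
  ... | inj₂ e = trans e eq
  ... | inj₁ e =
      trans (sym e) (trans (orient-∉ w R? (QuasiAt.∉Inv (quasiAt-tail w q)))
        (sym (parity-cons w Y (quasiAt-descent w q))))
  realises-quasi R? re {X@(x ∷ y ∷ z ∷ Y)} {zero} q eq
    with realises-triple R? re {X} {zero} {zero} {suc zero} {suc zero} (QuasiAt.increasing q) z≤n refl ℕ.≤-refl
           (inv-face w zero (QuasiAt.invʳ q)) (inv-face w (suc zero) (QuasiAt.invˡ q))
             (inv-face w (suc zero) (QuasiAt.invʳ q))
  ... | inj₁ e = trans e eq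
  ... | inj₂ e = contradiction
    (trans (sym (parity-ascent w (z ∷ Y) x⊁y)) (trans (sym eq)
      (trans e (trans (orient-∉ w R? (x⊁y ∘ inv-descent w)) (parity-ascent w Y x⊁y)))))
    (Bool.not-¬ refl ∘ sym)
    where
    x⊁y : ¬ Descent w x y
    x⊁y = quasiAt-ascent w {i = zero} q

  -- The lower ideal condition is `realises-quasi`, taken contrapositively for even parity. The
  -- prefix or suffix condition is the absence of alternation among the faces of an inversion.
  realises⇒consistent : ∀ {R : Pred (Tuple n (suc (suc k))) 0ℓ} (R? : Decidable R) {ρ : List (Tuple n (suc k))} →
                        R ⊆ Inv w → Realises w R? ρ → Consistent w R
  realises⇒consistent {k} {R} R? R⊆ re = record { R⊆Inv = R⊆ ; lowerIdeal = lower* ; prefixOrSuffix = segments }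
    where
    lower : ∀ {X Y} → QuasiRel w X Y → Y ∈ R → X ∈ R
    lower (odd {X} i qi meets par) p = orient-true⁻ w R? (QuasiAt.invˡ q)
      (trans (realises-quasi R? re q (trans (orient-true w R? (QuasiAt.invʳ q) p) (sym dir))) dir)
      where
      q = quasiAt⁺ w qi meets
      dir : ascentParity w X ≡ true
      dir = trans (quasiAt-parity w q) (isOdd-1ℙ (suc (suc k) ∸ suc (toℕ i)) par)
    lower (even {X} i qi meets par) p = orient-true⁻ w R? (QuasiAt.invʳ q)
      (Bool.¬-not λ e → contradiction
        (trans (sym (orient-true w R? (QuasiAt.invˡ q) p)) (trans (realises-quasi R? re q (trans e (sym dir))) dir))
          λ ())
      where
      q = quasiAt⁺ w qi meets
      dir : ascentParity w X ≡ false
      dir = trans (quasiAt-parity w q) (isOdd-0ℙ (suc (suc k) ∸ suc (toℕ i)) par)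
    lower* : ∀ {X Y} → Star (QuasiRel w) X Y → Y ∈ R → X ∈ R
    lower* ε        p = p
    lower* (r ◅ rs) p = lower r (lower* rs p)
    faces-alternate : ∀ {X : Tuple n (suc (suc (suc k)))} → X ∈ Inv w → ∀ {i j l} → i Fin.< j → j Fin.< l →
      does (R? (face X i)) ≡ does (R? (face X j)) ⊎ does (R? (face X j)) ≡ does (R? (face X l))
    faces-alternate {X} X∈ {i} {j} {l} i<j j<l
      with a , b , refl , refl , a≤b ← below i<j | b′ , c , eq , refl , b′≤c ← below j<l
      with realises-triple R? re {X} {a} {b} {b′} {c} (proj₁ X∈) a≤b eq b′≤c
             (inv-face w a (inv-face w (suc b) X∈)) (inv-face w c (inv-face w (inject₁ a) X∈))
               (inv-face w c (inv-face w (suc b) X∈))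
    ... | inj₁ e = inj₁ (trans (sym (orient-∈ w R? (inv-face w _ X∈))) (trans e (orient-∈ w R? (inv-face w _ X∈))))
    ... | inj₂ e = inj₂ (trans (sym (orient-∈ w R? (inv-face w _ X∈))) (trans e (orient-∈ w R? (inv-face w _ X∈))))
    segments : ∀ {X : Tuple n (suc (suc (suc k)))} → X ∈ Inv w →
      (∃ λ c → (λ Y → Packet X Y × Y ∈ R) ≐ Prefix X c) ⊎ (∃ λ c → (λ Y → Packet X Y × Y ∈ R) ≐ Suffix X c)
    segments {X} X∈ with nonalternating-segments (λ i → does (R? (face X i))) (faces-alternate X∈)
    ... | inj₁ (c , to , from) = inj₁ (c , to′ , λ { (i , c≤i , refl) → face-∈ X i , does-true⁻ (R? _) (from c≤i) })
      where
      to′ : ∀ {Y} → Packet X Y × Y ∈ R → Prefix X c Y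
      to′ (Y∈ , p) with i , refl ← ∈-tabulate⁻ {f = face X} Y∈ = i , to (dec-true (R? _) p) , refl
    ... | inj₂ (c , to , from) = inj₂ (c , to′ , λ { (i , i<c , refl) → face-∈ X i , does-true⁻ (R? _) (from i<c) })
      where
      to′ : ∀ {Y} → Packet X Y × Y ∈ R → Suffix X c Y
      to′ (Y∈ , p) with i , refl ← ∈-tabulate⁻ {f = face X} Y∈ = i , to (dec-true (R? _) p) , refl

  revConsistent : RevConsistent w (suc k)
  revConsistent {ρ = ρ} a = realises⇒consistent (Rev? w ρ) proj₁ (𝒜⇒realises w a)

-- Commutations: two orders following the same set.

before-pair : ∀ {A : Set} {x y a b : A} → Before (x ∷ y ∷ []) a b → a ≡ x × b ≡ y
before-pair (refl ∷ refl ∷ [])  = refl , refl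
before-pair (refl ∷ (_ ∷ʳ ()))
before-pair (_ ∷ʳ (refl ∷ ()))
before-pair (_ ∷ʳ (_ ∷ʳ ()))

turn-zip : ∀ {A : Set} {R S T : Rel A 0ℓ} s {x y} → (R x y → S x y → T x y) → (R y x → S y x → T y x) →
           turn s R x y → turn s S x y → turn s T x y
turn-zip true  f g = f
turn-zip false f g = g

module _ {n : ℕ} (w : Permutation′ n) where

  private
    variable
      k m : ℕ

  total-resp-↭ : {ρ σ : List (Tuple n k)} → ρ ↭ σ → IsTotalOrderOn (Inv w) ρ → IsTotalOrderOn (Inv w) σ
  total-resp-↭ ρ↭σ (u , mem) = Unique-resp-↭ ρ↭σ u , λ X → mk⇔
    (Equivalence.to (mem X) ∘ ∈-resp-↭ (↭-sym ρ↭σ)) (∈-resp-↭ ρ↭σ ∘ Equivalence.from (mem X))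

  orient-cong : {R S : Pred (Tuple n k) 0ℓ} (R? : Decidable R) (S? : Decidable S) → ∀ {X} →
                (X ∈ R → X ∈ S) → (X ∈ S → X ∈ R) → orient w R? X ≡ orient w S? X
  orient-cong R? S? {X} f g = cong (if does (Inv? w X) then_else ascentParity w X) (does-⇔ (mk⇔ f g) (R? X) (S? X))

  realises-cong : {R S : Pred (Tuple n (suc k)) 0ℓ} (R? : Decidable R) (S? : Decidable S) → R ≐ S →
                  ∀ {ρ} → Realises w R? ρ → Realises w S? ρ
  realises-cong R? S? (f , g) (realises t o) =
    realises t λ {Z} inc i<j l r → turn-≡ (sym (orient-cong R? S? {Z} f g)) (o inc i<j l r)

  swap-∷ : ∀ {x} {ρ σ : List (Tuple n k)} → Swap w ρ σ → Swap w (x ∷ ρ) (x ∷ σ)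
  swap-∷ (swap α β c) = swap (_ ∷ α) β c

  bubble : ∀ x α β → (∀ {y : Tuple n k} → y List.∈ α → Commute w x y) → Star (Swap w) (x ∷ α ++ β) (α ++ x ∷ β)
  bubble x []      β c = ε
  bubble x (y ∷ α) β c = swap [] (α ++ β) (c (here refl)) ◅ Star.gmap (y ∷_) swap-∷ (bubble x α β (c ∘ there))

  -- The tail of `ρ` is sorted into `σ` without `X`, and then `X` moves right to its place.
  -- Everything it passes comes after `X` in `ρ` and before `X` in `σ`, hence commutes with it.
  sort-by-swaps : ∀ {ρ σ : List (Tuple n k)} → Unique ρ → Unique σ → (∀ {X} → X List.∈ ρ → X List.∈ σ) →
    (∀ {X} → X List.∈ σ → X List.∈ ρ) →
    (∀ {X Y} → Before ρ X Y → Before σ Y X → Commute w X Y) → Star (Swap w) ρ σ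
  sort-by-swaps {ρ = []}    {[]}    _ _ f g c = ε
  sort-by-swaps {ρ = []}    {Y ∷ σ} _ _ f g c with () ← g (here refl)
  sort-by-swaps {ρ = X ∷ ρ} {σ} (X≢ ∷ u) v f g c with α , β , refl ← ∈-∃++ (f (here refl)) =
    Star.gmap (X ∷_) swap-∷ (sort-by-swaps u v′ f′ g′ c′) ◅◅ bubble X α β commutes
    where
    shifted : α ++ X ∷ β ↭ X ∷ α ++ β
    shifted = shift X α β
    X∉ : ∀ {Y} → Y List.∈ α ++ β → X ≢ Y
    X∉ p with Unique-resp-↭ shifted v
    ... | X≢′ ∷ _ = All.lookup X≢′ p
    v′ : Unique (α ++ β)
    v′ with Unique-resp-↭ shifted v
    ... | _ ∷ v′ = v′
    f′ : ∀ {Y} → Y List.∈ ρ → Y List.∈ α ++ β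
    f′ p with ∈-resp-↭ shifted (f (there p))
    ... | here refl = contradiction refl (All.lookup X≢ p)
    ... | there q   = q
    g′ : ∀ {Y} → Y List.∈ α ++ β → Y List.∈ ρ
    g′ p with g (∈-resp-↭ (↭-sym shifted) (there p))
    ... | here refl = contradiction refl (X∉ p)
    ... | there q   = q
    c′ : ∀ {Y Z} → Before ρ Y Z → Before (α ++ β) Z Y → Commute w Y Z
    c′ b b′ = c (_ ∷ʳ b) (⊆-trans b′ (++⁺ (⊆-refl {x = α}) (X ∷ʳ ⊆-refl)))
    commutes : ∀ {Y} → Y List.∈ α → Commute w X Y
    commutes p = c (before-head (g′ (∈-++⁺ˡ p))) (before-across p (here refl))

  commute-sym : ∀ {X Y : Tuple n k} → Commute w X Y → Commute w Y X
  commute-sym c =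
    record { X∈Inv = Y∈Inv ; Y∈Inv = X∈Inv ; X≰Y = Y≰X ; Y≰X = X≰Y ; noPacket = λ inc (p , q) → noPacket inc (q , p) }
    where open Commute c

  module _ {R : Pred (Tuple n (suc k)) 0ℓ} (R? : Decidable R) where

    -- Two elements comparable in `𝒫`, or lying in a common packet, have their order dictated by the
    -- directions, so `ρ` and `σ` would agree on them.
    opposite⇒commute : ∀ {ρ σ} → Realises w R? ρ → Realises w R? σ → ∀ {X Y} → Before ρ X Y → Before σ Y X →
      Commute w X Y
    opposite⇒commute {ρ} {σ} reρ reσ {X} {Y} b b′ = record
      { X∈Inv = Realises.inv-∈ reρ (before-∈ˡ b)
      ; Y∈Inv = Realises.inv-∈ reρ (before-∈ʳ b)
      ; X≰Y = λ s → incomparable reσ b′ s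
      ; Y≰X = λ s → incomparable reρ b s
      ; noPacket = noPacket
      }
      where
      incomparable : ∀ {ρ X Y} → Realises w R? ρ → Before ρ X Y → ¬ Star (QuasiRel w) Y X
      incomparable re b s with star-before (Realises.unique re) (quasi-before w R? (Realises.oriented re)) s
      ... | inj₁ refl = before-irrefl (Realises.unique re) b
      ... | inj₂ b′   = before-asym (Realises.unique re) b b′
      noPacket : ∀ {Z} → Z ∈ Increasing → ¬ (X ∈ Packet Z × Y ∈ Packet Z)
      noPacket {Z} inc (p , q) with ∈-tabulate⁻ {f = face Z} p | ∈-tabulate⁻ {f = face Z} q
      ... | i , refl | j , refl with Fin.<-cmp i j | Realises.inv-∈ reρ (before-∈ˡ b) | Realises.inv-∈ reρ (before-∈ʳ b)
      ... | tri≈ _ refl _ | _ | _ = before-irrefl (Realises.unique reρ) b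
      ... | tri< i<j _ _  | l | r
        with orient w R? Z | Realises.oriented reρ inc i<j l r | Realises.oriented reσ inc i<j l r
      ...   | true  | _ | o = before-asym (Realises.unique reσ) o b′
      ...   | false | o | _ = before-asym (Realises.unique reρ) o b
      noPacket {Z} inc (p , q) | i , refl | j , refl | tri> _ _ j<i | l | r
        with orient w R? Z | Realises.oriented reρ inc j<i r l | Realises.oriented reσ inc j<i r l
      ...   | true  | o | _ = before-asym (Realises.unique reρ) o b
      ...   | false | _ | o = before-asym (Realises.unique reσ) o b′

    realises-unique : ∀ {ρ σ} → Realises w R? ρ → Realises w R? σ → Star (Swap w) ρ σ
    realises-unique reρ reσ = sort-by-swaps (Realises.unique reρ) (Realises.unique reσ)
      (Realises.∈-inv reσ ∘ Realises.inv-∈ reρ) (Realises.∈-inv reρ ∘ Realises.inv-∈ reσ) (opposite⇒commute reρ reσ)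

    -- Directions concern only pairs inside a packet, and `noPacket` says that the swapped pair is
    -- not one.
    swap-realises : ∀ α β {X Y} → Commute w X Y → Realises w R? (α ++ X ∷ Y ∷ β) → Realises w R? (α ++ Y ∷ X ∷ β)
    swap-realises α β {X} {Y} c re = realises (total-resp-↭ (↭-++⁺ˡ α (↭-swap X Y ↭-refl)) total)
      λ {Z} inc {i} {j} i<j l r → turn-map (orient w R? Z)
        (move inc (face-∈ Z i) (face-∈ Z j)) (move inc (face-∈ Z j) (face-∈ Z i)) (oriented inc i<j l r)
      where
      open Realises re
      move : ∀ {Z A B} → Increasing Z → A ∈ Packet Z → B ∈ Packet Z →
             Before (α ++ X ∷ Y ∷ β) A B → Before (α ++ Y ∷ X ∷ β) A B
      move {Z} inc p q = before-infix α {xs = X ∷ Y ∷ []} {ys = Y ∷ X ∷ []} (∈-resp-↭ (↭-swap X Y ↭-refl)) λ b →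
        let eq , eq′ = before-pair b in
        contradiction (subst (Packet Z) eq p , subst (Packet Z) eq′ q) (Commute.noPacket c inc)

    ∼-realises : ∀ {ρ σ} → EqClosure (Swap w) ρ σ → Realises w R? ρ → Realises w R? σ
    ∼-realises ε re = re
    ∼-realises (fwd (swap α β c) ◅ ss) re = ∼-realises ss (swap-realises α β c re)
    ∼-realises (bwd (swap α β c) ◅ ss) re = ∼-realises ss (swap-realises α β (commute-sym c) re)

  -- Packet flips: two sets differing in one element.

  module _ {R S : Pred (Tuple n (suc (suc k))) 0ℓ} (R? : Decidable R) (S? : Decidable S)
           {X : Tuple n (suc (suc k))} (X∈Inv : X ∈ Inv w) (X∈S : X ∈ S)
           (R⇒S : ∀ {Z} → Z ≢ X → Z ∈ R → Z ∈ S) (S⇒R : ∀ {Z} → Z ≢ X → Z ∈ S → Z ∈ R) where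

    -- By `packet-unique`, a `Z` other than `X` has at most one face in the reversed block, so only
    -- the direction of `X` changes.
    flip-realises : ∀ α β → Realises w R? (α ++ lex X ++ β) → Realises w S? (α ++ antilex X ++ β)
    flip-realises α β re = realises (total-resp-↭ (↭-++⁺ˡ α (↭-++⁺ʳ β (↭-reverse (antilex X)))) total) oriented′
      where
      open Realises re
      oriented′ : Oriented w (α ++ antilex X ++ β) (orient w S?)
      oriented′ {Z} inc {i} {j} i<j l r with Z ≟ X
      ... | yes refl = turn-≡ (orient-true w S? X∈Inv X∈S)
        (before-++⁺ʳ α (before-++⁺ˡ (before-tabulate⁺ (face X) i<j)))
      ... | no Z≢X = turn-≡ (sym (orient-cong R? S? (R⇒S Z≢X) (S⇒R Z≢X)))
        (turn-map (orient w R? Z) (move (Fin.<⇒≢ i<j)) (move (Fin.<⇒≢ i<j ∘ sym)) (oriented inc i<j l r))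
        where
        move : ∀ {a b} → a ≢ b → Before (α ++ lex X ++ β) (face Z a) (face Z b) →
          Before (α ++ antilex X ++ β) (face Z a) (face Z b)
        move a≢b = before-infix α (∈-resp-↭ (↭-reverse (antilex X))) λ bf →
          contradiction (packet-unique inc (proj₁ X∈Inv) a≢b
            (before-∈ʳ (before-reverse⁻ bf)) (before-∈ˡ (before-reverse⁻ bf))) Z≢X

    module _ (X∉R : X ∉ R) {ρ σ : List (Tuple n (suc k))} (reρ : Realises w R? ρ) (reσ : Realises w S? σ) where
      open DecMembership (_≟_ {n} {suc k}) using (_∈?_)
      open DecSublist (_≟_ {n} {suc k}) using (_⊆?_)
      private
        module ρ = Realises reρ
        module σ = Realises reσ

      -- Precedence in both `ρ` and `σ` is a strict partial order. The packet of `X` is an antichain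
      -- in it, because `ρ` lists the packet in lex order and `σ` in antilex order. `Above` is the
      -- set of elements strictly above that antichain.
      Above : Pred (Tuple n (suc k)) 0ℓ
      Above Y = Any (λ A → Before ρ A Y × Before σ A Y) (antilex X)

      above? : Decidable Above
      above? Y = any? (λ A → (A ∷ Y ∷ []) ⊆? ρ ×-dec (A ∷ Y ∷ []) ⊆? σ) (antilex X)

      low? : Decidable (λ Y → Y ∉ Packet X × ¬ Above Y)
      low? Y = ¬? (Y ∈? antilex X) ×-dec ¬? (above? Y)

      high? : Decidable (λ Y → Y ∉ Packet X × Above Y)
      high? Y = ¬? (Y ∈? antilex X) ×-dec above? Y

      lows highs : List (Tuple n (suc k))
      lows  = filter low? ρ
      highs = filter high? ρ

      gathered : List (Tuple n (suc k))
      gathered = lows ++ lex X ++ highs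

      above-trans : ∀ {A B} → Before ρ A B → Before σ A B → Above A → Above B
      above-trans b b′ above with C , C∈ , (c , c′) ← find above =
        lose C∈ (before-trans ρ.unique c b , before-trans σ.unique c′ b′)

      packet-lex : ∀ {A B} → A ∈ Packet X → B ∈ Packet X → Before ρ A B → Before (lex X) A B
      packet-lex p q b =
        subst (λ xs → Before xs _ _) (packet-∉ w R? reρ X∈Inv X∉R) (before-filter⁺ (_∈? antilex X) b p q)

      packet-antilex : ∀ {A B} → A ∈ Packet X → B ∈ Packet X → Before σ A B → Before (antilex X) A B
      packet-antilex p q b =
        subst (λ xs → Before xs _ _) (packet-∈ w S? reσ X∈Inv X∈S) (before-filter⁺ (_∈? antilex X) b p q)

      packet-not-above : ∀ {A} → A ∈ Packet X → ¬ Above A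
      packet-not-above p above with C , C∈ , (c , c′) ← find above =
        before-asym (antilex-unique (proj₁ X∈Inv)) (packet-antilex C∈ p c′) (before-reverse⁻ (packet-lex C∈ p c))

      ∈-lex : ∀ {A} → A ∈ Packet X → A List.∈ lex X
      ∈-lex = ∈-resp-↭ (↭-sym (↭-reverse (antilex X)))

      gathered-packet : ∀ {A B} → A ∈ Packet X → B ∈ Packet X → Before ρ A B → Before gathered A B
      gathered-packet p q b = before-++⁺ʳ lows (before-++⁺ˡ (packet-lex p q b))

      -- `gathered` extends the common order of `ρ` and `σ`. Elements over a packet element or over
      -- a high element are high, and an element under a packet element cannot be above the packet,
      -- by `packet-not-above`.
      gathered-before : ∀ {A B} → Before ρ A B → Before σ A B → Before gathered A B
      gathered-before {A} {B} b b′ with A ∈? antilex X | B ∈? antilex X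
      ... | yes p | yes q = gathered-packet p q b
      ... | yes p | no ¬q =
          before-++⁺ʳ lows (before-across (∈-lex p) (∈-filter⁺ high? (before-∈ʳ b) (¬q , lose p (b , b′))))
      ... | no ¬p | yes q =
          before-across (∈-filter⁺ low? (before-∈ˡ b) (¬p , packet-not-above q ∘ above-trans b b′)) (∈-++⁺ˡ (∈-lex q))
      ... | no ¬p | no ¬q with above? A | above? B
      ...   | yes a | yes a′ = before-++⁺ʳ lows (before-++⁺ʳ (lex X) (before-filter⁺ high? b (¬p , a) (¬q , a′)))
      ...   | no ¬a | yes a′ =
          before-across (∈-filter⁺ low? (before-∈ˡ b) (¬p , ¬a))
            (∈-++⁺ʳ (lex X) (∈-filter⁺ high? (before-∈ʳ b) (¬q , a′)))
      ...   | no ¬a | no ¬a′ = before-++⁺ˡ (before-filter⁺ low? b (¬p , ¬a) (¬q , ¬a′))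
      ...   | yes a | no ¬a′ = contradiction (above-trans b b′ a) ¬a′

      gathered-total : IsTotalOrderOn (Inv w) gathered
      gathered-total =
        Unique.++⁺ (Unique.filter⁺ low? ρ.unique)
          (Unique.++⁺ (lex-unique (proj₁ X∈Inv)) (Unique.filter⁺ high? ρ.unique)
            λ (p , q) → proj₁ (proj₂ (∈-filter⁻ high? {xs = ρ} q)) (∈-resp-↭ (↭-reverse (antilex X)) p))
          (λ (p , q) → disjoint (proj₂ (∈-filter⁻ low? {xs = ρ} p)) (∈-++⁻ (lex X) q)) ,
        λ Y → mk⇔ to from
        where
        disjoint : ∀ {Y} → Y ∉ Packet X × ¬ Above Y → ¬ (Y List.∈ lex X ⊎ Y List.∈ highs)
        disjoint (¬p , ¬a) (inj₁ q) = ¬p (∈-resp-↭ (↭-reverse (antilex X)) q)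
        disjoint (¬p , ¬a) (inj₂ q) = ¬a (proj₂ (proj₂ (∈-filter⁻ high? {xs = ρ} q)))
        to : ∀ {Y} → Y List.∈ gathered → Y ∈ Inv w
        to p with ∈-++⁻ lows p
        ... | inj₁ q = ρ.inv-∈ (proj₁ (∈-filter⁻ low? q))
        ... | inj₂ q with ∈-++⁻ (lex X) q
        ...   | inj₁ r = packet-inv w X∈Inv (∈-resp-↭ (↭-reverse (antilex X)) r)
        ...   | inj₂ r = ρ.inv-∈ (proj₁ (∈-filter⁻ high? r))
        from : ∀ {Y} → Y ∈ Inv w → Y List.∈ gathered
        from {Y} p with Y ∈? antilex X | above? Y
        ... | yes q | _     = ∈-++⁺ʳ lows (∈-++⁺ˡ (∈-lex q))
        ... | no ¬q | yes a = ∈-++⁺ʳ lows (∈-++⁺ʳ (lex X) (∈-filter⁺ high? (ρ.∈-inv p) (¬q , a)))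
        ... | no ¬q | no ¬a = ∈-++⁺ˡ (∈-filter⁺ low? (ρ.∈-inv p) (¬q , ¬a))

      -- For `Z` other than `X` the directions under `R` and `S` agree, so `ρ` and `σ` order the two
      -- faces alike and `gathered-before` applies. The packet of `X` keeps its order from `ρ`.
      gathered-realises : Realises w R? gathered
      gathered-realises = realises gathered-total oriented
        where
        oriented : Oriented w gathered (orient w R?)
        oriented {Z} inc {i} {j} i<j l r with Z ≟ X
        ... | yes refl =
            turn-map (orient w R? Z) (gathered-packet (face-∈ Z i) (face-∈ Z j))
              (gathered-packet (face-∈ Z j) (face-∈ Z i)) (ρ.oriented inc i<j l r)
        ... | no Z≢X   = turn-zip (orient w R? Z) gathered-before gathered-before (ρ.oriented inc i<j l r)
          (turn-≡ (orient-cong R? S? (R⇒S Z≢X) (S⇒R Z≢X)) (σ.oriented inc i<j l r))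

      flippable : ∃₂ λ τ τ′ → Realises w R? τ × Flip w τ τ′ × Realises w S? τ′
      flippable =
        gathered , lows ++ antilex X ++ highs , gathered-realises , flip lows highs X∈Inv ,
        flip-realises lows highs gathered-realises

-- The isomorphism and its inverse.

module _ {n : ℕ} (w : Permutation′ n) {k : ℕ} where

  open 𝒞

  private
    B : Set
    B = ℬ w (suc k)
    C : Set₁
    C = 𝒞 w (suc (suc k))
    rev : B → C
    rev = revMap w (revConsistent w)
    variable
      R S T : C

  ≈𝒞-sym : _≈𝒞_ w R S → _≈𝒞_ w S R
  ≈𝒞-sym (f , g) = g , f

  ≈𝒞-trans : _≈𝒞_ w R S → _≈𝒞_ w S T → _≈𝒞_ w R T
  ≈𝒞-trans (f , g) (f′ , g′) = f′ ∘ f , g ∘ g′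

  ⋖-respˡ : _≈𝒞_ w R S → _⋖_ w S T → _⋖_ w R T
  ⋖-respˡ (f , g) (S⊆T , X , to , from) =
    S⊆T ∘ f , X , (λ (t , ¬r) → to (t , ¬r ∘ g)) , λ eq → let t , ¬s = from eq in t , ¬s ∘ f

  -- `_≤𝒞_` permits an equality of sets only at its end. One at the start is absorbed into the first
  -- covering, or into the final equality if the chain is empty.
  ≤𝒞-respˡ : _≈𝒞_ w R S → _≤𝒞_ w S T → _≤𝒞_ w R T
  ≤𝒞-respˡ {R} {S} {T} e (.S , ε , e′)      = R , ε , ≈𝒞-trans {R} {S} {T} e e′
  ≤𝒞-respˡ {R} {S} {T} e (S′ , _◅_ {j = j} c cs , e′) = S′ , ⋖-respˡ {R} {S} {j} e c ◅ cs , e′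

  ≤𝒞-trans : _≤𝒞_ w R S → _≤𝒞_ w S T → _≤𝒞_ w R T
  ≤𝒞-trans {R} {S} {T} (R′ , cs , e) s≤t =
    let S′ , cs′ , e′ = ≤𝒞-respˡ {R′} {S} {T} e s≤t in S′ , cs ◅◅ cs′ , e′

  ⋖*-⊆ : Star (_⋖_ w) R S → set R ⊆ set S
  ⋖*-⊆ ε        = id
  ⋖*-⊆ (c ◅ cs) = ⋖*-⊆ cs ∘ proj₁ c

  ≤𝒞-⊆ : _≤𝒞_ w R S → set R ⊆ set S
  ≤𝒞-⊆ (_ , cs , e) = proj₁ e ∘ ⋖*-⊆ cs

  ≤𝒞-isPartialOrder : IsPartialOrder (_≈𝒞_ w {suc (suc k)}) (_≤𝒞_ w)
  ≤𝒞-isPartialOrder = record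
    { isPreorder = record
      { isEquivalence = record
        { refl  = id , id
        ; sym   = λ {R} {S} → ≈𝒞-sym {R} {S}
        ; trans = λ {R} {S} {T} → ≈𝒞-trans {R} {S} {T}
        }
      ; reflexive = λ {R} e → R , ε , e
      ; trans     = λ {R} {S} {T} → ≤𝒞-trans {R} {S} {T}
      }
    ; antisym = λ {R} {S} p q → ≤𝒞-⊆ {R} {S} p , ≤𝒞-⊆ {S} {R} q
    }

  rev-realises : (ρ : B) → Realises w (set? (rev ρ)) (proj₁ ρ)
  rev-realises (_ , a) = 𝒜⇒realises w a

  rev-characterised : ∀ (R : C) (ρ : B) → Realises w (set? R) (proj₁ ρ) → _≈𝒞_ w (rev ρ) R
  rev-characterised R ρ = realises⇒Rev w (set? R) (Consistent.R⊆Inv (consistent R))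

  realises-swaps : ∀ (R S : C) → _≈𝒞_ w R S → ∀ {ρ σ} → Realises w (set? R) ρ → Realises w (set? S) σ →
    Star (Swap w) ρ σ
  realises-swaps R S e reρ = realises-unique w (set? S) (realises-cong w (set? R) (set? S) e reρ)

  swaps⇒∼ : ∀ {ρ σ : List (Tuple n (suc k))} → Star (Swap w) ρ σ → EqClosure (Swap w) ρ σ
  swaps⇒∼ = Star.map fwd

  swaps⇒≤ : ∀ {ρ σ : List (Tuple n (suc k))} → Star (Swap w) ρ σ → Star (Swap w ∪ᵣ Flip w) ρ σ
  swaps⇒≤ = Star.map inj₁

  rev-cong : ∀ {ρ σ : B} → _∼_ w ρ σ → _≈𝒞_ w (rev ρ) (rev σ)
  rev-cong {ρ} {σ} ρ∼σ =
    ≈𝒞-sym {rev σ} {rev ρ} (rev-characterised (rev ρ) σ (∼-realises w (set? (rev ρ)) ρ∼σ (rev-realises ρ)))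

  rev-swaps : ∀ {ρ σ : B} → _≈𝒞_ w (rev ρ) (rev σ) → Star (Swap w) (proj₁ ρ) (proj₁ σ)
  rev-swaps {ρ} {σ} e = realises-swaps (rev ρ) (rev σ) e (rev-realises ρ) (rev-realises σ)

  -- By `flip-realises` the new order follows the old reversal set with `X` added. The set really
  -- grows, since the packet of `X` stands in `ρ` in lex order.
  flip-⋖ : ∀ {ρ σ : List (Tuple n (suc k))} (a : 𝒜 w (suc k) ρ) → Flip w ρ σ →
    Σ[ b ∈ 𝒜 w (suc k) σ ] _⋖_ w (rev (ρ , a)) (rev (σ , b))
  flip-⋖ {ρ} {σ} a (flip α {X} β X∈) = realises⇒𝒜 w R∪X? re , proj₂ rev≐ ∘ inj₁ , X , to , from
    where
    R∪X? : Decidable (λ Z → Z ∈ Rev w ρ ⊎ X ≡ Z)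
    R∪X? Z = Rev? w ρ Z ⊎-dec X ≟ Z
    X∉ : X ∉ Rev w ρ
    X∉ p =
      before-asym (Realises.unique (𝒜⇒realises w a)) (before-∈ w (Rev? w ρ) (𝒜⇒realises w a) X∈ p {zero} {suc zero} z<s)
      (before-++⁺ʳ α (before-++⁺ˡ (before-reverse⁺ (before-tabulate⁺ (face X) {zero} {suc zero} z<s))))
    re : Realises w R∪X? σ
    re =
      flip-realises w (Rev? w ρ) R∪X? X∈ (inj₂ refl) (λ _ → inj₁)
        (λ Z≢X → fromInj₁ (λ eq → contradiction (sym eq) Z≢X)) α β (𝒜⇒realises w a)
    rev≐ : Rev w σ ≐ (λ Z → Z ∈ Rev w ρ ⊎ X ≡ Z)
    rev≐ = realises⇒Rev w R∪X? (λ { (inj₁ p) → proj₁ p ; (inj₂ refl) → X∈ }) re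
    to : ∀ {Z} → Z ∈ Rev w σ × Z ∉ Rev w ρ → X ≡ Z
    to (p , ¬q) = fromInj₂ (λ q → contradiction q ¬q) (proj₁ rev≐ p)
    from : ∀ {Z} → X ≡ Z → Z ∈ Rev w σ × Z ∉ Rev w ρ
    from refl = proj₂ rev≐ (inj₂ refl) , X∉

  rev-mono : ∀ {ρ σ : B} → _≤ℬ_ w ρ σ → _≤𝒞_ w (rev ρ) (rev σ)
  rev-mono {ρ , a} {σ , b} ε = rev (ρ , a) , ε , id , id
  rev-mono {ρ , a} {σ , b} (inj₁ s@(swap α β c) ◅ ss) =
    ≤𝒞-respˡ {rev (ρ , a)} {rev (_ , a′)} {rev (σ , b)} (rev-cong {ρ , a} {_ , a′} (fwd s ◅ ε))
      (rev-mono {_ , a′} {σ , b} ss)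
    where
    a′ = realises⇒𝒜 w (Rev? w ρ) (swap-realises w (Rev? w ρ) α β c (𝒜⇒realises w a))
  rev-mono {ρ , a} {σ , b} (inj₂ f ◅ ss)
    with a′ , c ← flip-⋖ a f | S , cs , e ← rev-mono {_ , proj₁ (flip-⋖ a f)} {σ , b} ss = S , c ◅ cs , e

  -- For each covering, `realisation` supplies an order following the larger set, and `flippable`
  -- compares it with the present one to make the packet contiguous. The gathered order follows the
  -- same set as the present one, so swaps lead to it before the flip.
  ⋖*-lift : ∀ {ρ} → Realises w (set? R) ρ → Star (_⋖_ w) R S →
            ∃ λ σ → Star (Swap w ∪ᵣ Flip w) ρ σ × Realises w (set? S) σ
  ⋖*-lift {ρ = ρ} re ε = ρ , ε , re
  ⋖*-lift {R = R} {S} re (_◅_ {j = T} (R⊆T , X , to , from) cs)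
    with τ , τ′ , reτ , f , reτ′ ← flippable w (set? R) (set? T)
      (Consistent.R⊆Inv (consistent T) (proj₁ (from refl))) (proj₁ (from refl))
           (λ _ → R⊆T) (λ {Z} Z≢X t → decidable-stable (set? R Z) λ ¬r → Z≢X (sym (to (t , ¬r))))
           (proj₂ (from refl)) re (proj₂ (realisation w (set? T) (consistent T)))
    with σ , ss , reσ ← ⋖*-lift {R = T} {S} reτ′ cs
    = σ , swaps⇒≤ (realises-unique w (set? R) re reτ) ◅◅ inj₂ f ◅ ss , reσ

  rev-cancel : ∀ {ρ σ : B} → _≤𝒞_ w (rev ρ) (rev σ) → _≤ℬ_ w ρ σ
  rev-cancel {ρ} {σ} (S , cs , e) with τ , ss , re ← ⋖*-lift {rev ρ} {S} (rev-realises ρ) cs =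
    ss ◅◅ swaps⇒≤ (realises-swaps S (rev σ) e re (rev-realises σ))

  ≤ℬ-isPartialOrder : IsPartialOrder (_∼_ w {suc k}) (_≤ℬ_ w)
  ≤ℬ-isPartialOrder = record
    { isPreorder = record
      { isEquivalence = On.isEquivalence proj₁ (EqClosure.isEquivalence (Swap w))
      -- Equivalent orders have equal reversal sets, and sorting then turns the symmetric closure
      -- into forward swaps.
      ; reflexive     = λ {ρ} {σ} e → swaps⇒≤ (rev-swaps {ρ} {σ} (rev-cong {ρ} {σ} e))
      ; trans         = _◅◅_
      }
    -- Antisymmetry comes from inclusion of reversal sets in both directions.
    ; antisym = λ {ρ} {σ} p q → swaps⇒∼ (rev-swaps {ρ} {σ}
        (≤𝒞-⊆ {rev ρ} {rev σ} (rev-mono {ρ} {σ} p) , ≤𝒞-⊆ {rev σ} {rev ρ} (rev-mono {σ} {ρ} q)))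
    }

  inverse : C → B
  inverse R = let ρ , re = realisation w (set? R) (consistent R) in ρ , realises⇒𝒜 w (set? R) re

  inverse-realises : ∀ R → Realises w (set? R) (proj₁ (inverse R))
  inverse-realises R = proj₂ (realisation w (set? R) (consistent R))

  rev-inverseˡ : ∀ {R} {ρ : B} → _∼_ w ρ (inverse R) → _≈𝒞_ w (rev ρ) R
  rev-inverseˡ {R} {ρ} e =
    rev-characterised R ρ (∼-realises w (set? R) (EqClosure.symmetric (Swap w) e) (inverse-realises R))

  rev-inverseʳ : ∀ {ρ : B} {R} → _≈𝒞_ w R (rev ρ) → _∼_ w (inverse R) ρ
  rev-inverseʳ {ρ} {R} e = swaps⇒∼ (realises-swaps R (rev ρ) e (inverse-realises R) (rev-realises ρ))

  rev-isOrderIsomorphism : IsOrderIsomorphism (_∼_ w) (_≈𝒞_ w) (_≤ℬ_ w) (_≤𝒞_ w) rev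
  rev-isOrderIsomorphism = record
    { isOrderMonomorphism = record
      { isOrderHomomorphism = record
        { cong = λ {ρ} {σ} → rev-cong {ρ} {σ}
        ; mono = λ {ρ} {σ} → rev-mono {ρ} {σ}
        }
      ; injective = λ {ρ} {σ} e → swaps⇒∼ (rev-swaps {ρ} {σ} e)
      ; cancel    = λ {ρ} {σ} → rev-cancel {ρ} {σ}
      }
    ; surjective = λ R → inverse R , λ {ρ} → rev-inverseˡ {R} {ρ}
    }

  -- Both sides consist of the orders that follow `R`: following `R` is invariant under
  -- commutations, and any two such orders are joined by swaps.
  class-inverse : ∀ R → Class w (inverse R) ≐ ℒ w R
  class-inverse R =
    (λ { (_ , e) → realises⇒ℒ w R (∼-realises w (set? R) (EqClosure.symmetric (Swap w) e) (inverse-realises R)) }) ,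
    λ l → let re = ℒ⇒realises w R l in
      realises⇒𝒜 w (set? R) re , swaps⇒∼ (realises-unique w (set? R) re (inverse-realises R))

theorem3p12 : (n k : ℕ) → 1 ≤ n → 1 ≤ k → k ≤ n → (w : Permutation′ n) →
    IsPartialOrder (_∼_ w {k}) (_≤ℬ_ w) ×
    IsPartialOrder (_≈𝒞_ w {suc k}) (_≤𝒞_ w) ×
    (Σ[ wd ∈ RevConsistent w k ]
    IsOrderIsomorphism (_∼_ w) (_≈𝒞_ w) (_≤ℬ_ w) (_≤𝒞_ w) (revMap w wd) ×
    (Σ[ inv ∈ (𝒞 w (suc k) → ℬ w k) ]
    Inverseᵇ (_∼_ w) (_≈𝒞_ w) (revMap w wd) inv ×
    ((R : 𝒞 w (suc k)) → Class w (inv R) ≐ ℒ w R)))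
theorem3p12 n (suc k) _ _ _ w =
  ≤ℬ-isPartialOrder w , ≤𝒞-isPartialOrder w , revConsistent w , rev-isOrderIsomorphism w , inverse w ,
  ((λ {R} {ρ} → rev-inverseˡ w {k} {R} {ρ}) , λ {ρ} {R} → rev-inverseʳ w {k} {ρ} {R}) , class-inverse w
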